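{- For every integer $n > 3$, $A_{\text{no4c}}(n) \leq n-2$.
   Context: For a finite set $\mathcal P \subset \mathbb{R}^2$, $A(\mathcal P)$ denotes the number of distinct values in the open interval $(0,\pi)$ of angles $\angle pqr$ with $p,q,r$ distinct points of $\mathcal P$ (angles of $0$ and $\pi$ are not counted). $A_{\text{no4c}}(n)$ is the minimum of $A(\mathcal P)$ over all sets $\mathcal P \subset \mathbb{R}^2$ of $n$ points, not all collinear, such that no four points of $\mathcal P$ lie on a common circle. -}

module Defs where

open import Level using (0ℓ) renaming (suc to lsuc)
open import Algebra.Bundles using (CommutativeRing; Semiring)
open import Data.Nat.Base as ℕ using (ℕ; _!)
open import Data.Fin.Base using (Fin; toℕ)
open import Data.Product.Base using (∃; ∃-syntax; _×_; _,_)
open import Function.Definitions using (Injective)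
open import Relation.Binary.Core using (Rel)
open import Relation.Binary.PropositionalEquality.Core using (_≡_; _≢_)
open import Relation.Binary.Structures using (IsStrictTotalOrder)
open import Relation.Nullary.Negation.Core using (¬_)
open import Relation.Unary using (Pred; Satisfiable)
import Algebra.Definitions.RawSemiring as RawSemiringDefs
import Algebra.Properties.Semiring.Sum as SemiringSum
import Relation.Binary.Construct.StrictToNonStrict as StrictToNonStrict

-- The real numbers, given by their usual axioms: a Dedekind-complete ordered
-- field (unique up to unique isomorphism).  The value of 0# ⁻¹ is unspecified.
record RealNumbers : Set (lsuc 0ℓ) where
  infix 4 _<_
  infix 8 _⁻¹
  field
    commutativeRing : CommutativeRing 0ℓ 0ℓ

  open CommutativeRing commutativeRing public

  field
    _<_                : Rel Carrier 0ℓ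
    isStrictTotalOrder : IsStrictTotalOrder _≈_ _<_

  open StrictToNonStrict _≈_ _<_ public using (_≤_)

  IsUpperBound : Pred Carrier 0ℓ → Carrier → Set
  IsUpperBound S b = ∀ x → S x → x ≤ b

  field
    0<1      : 0# < 1#
    +-mono-< : ∀ x y z → x < y → x + z < y + z
    *-pos    : ∀ x y → 0# < x → 0# < y → 0# < x * y
    _⁻¹      : Carrier → Carrier
    inverse  : ∀ x → ¬ x ≈ 0# → x * x ⁻¹ ≈ 1#
    complete : (S : Pred Carrier 0ℓ) → Satisfiable S → ∃ (IsUpperBound S) →
               ∃[ s ] IsUpperBound S s × (∀ b → IsUpperBound S b → s ≤ b)

module Analysis (R : RealNumbers) where

  open RealNumbers R
  open RawSemiringDefs (Semiring.rawSemiring semiring) using (_^_) renaming (_×_ to _•_)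
  open SemiringSum semiring using (sum-syntax)

  Converges : (ℕ → Carrier) → Carrier → Set
  Converges a l = ∀ ε → 0# < ε →
    ∃[ N ] ∀ m → N ℕ.≤ m → (l - ε < a m) × (a m < l + ε)

  cosTerm : Carrier → ℕ → Carrier
  cosTerm x k = (- 1#) ^ k * x ^ (2 ℕ.* k) * (((2 ℕ.* k) !) • 1#) ⁻¹

  -- Cos x c says that cos x = c: the power series of the cosine at x sums to c.
  Cos : Carrier → Carrier → Set
  Cos x c = Converges (λ m → ∑[ k < m ] cosTerm x (toℕ k)) c

  -- π is twice the least positive zero of the cosine.
  IsPi : Carrier → Set
  IsPi π = ∃[ h ] π ≈ h + h × 0# < h × Cos h 0# ×
           (∀ t → 0# < t → t < h → ¬ Cos t 0#)

module Plane (R : RealNumbers) where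

  open RealNumbers R
  open Analysis R

  Point : Set
  Point = Carrier × Carrier

  infix 4 _≈ₚ_
  infixl 6 _-ₚ_
  infixl 7 _∙_

  _≈ₚ_ : Rel Point 0ℓ
  (x , y) ≈ₚ (x′ , y′) = x ≈ x′ × y ≈ y′

  _-ₚ_ : Point → Point → Point
  (x , y) -ₚ (x′ , y′) = x - x′ , y - y′

  _∙_ : Point → Point → Carrier
  (x , y) ∙ (x′ , y′) = x * x′ + y * y′

  IsNorm : Point → Carrier → Set
  IsNorm u r = 0# ≤ r × r * r ≈ u ∙ u

  -- θ is the radian measure of the angle between u and v (when both are
  -- nonzero): the number in [0,π] with ∥u∥ ∥v∥ cos θ = u ∙ v.
  IsAngleBetween : Point → Point → Carrier → Set
  IsAngleBetween u v θ =
    (∃[ π ] IsPi π × 0# ≤ θ × θ ≤ π) ×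
    (∃[ r ] ∃[ s ] ∃[ c ]
       IsNorm u r × IsNorm v s × Cos θ c × r * s * c ≈ u ∙ v)

  IsAngle : Point → Point → Point → Carrier → Set
  IsAngle p q r θ = IsAngleBetween (p -ₚ q) (r -ₚ q) θ

  -- A set of n points is given by an enumeration without repetitions.
  Config : ℕ → Set
  Config n = Fin n → Point

  Distinct : ∀ {n} → Config n → Set
  Distinct P = Injective _≡_ _≈ₚ_ P

  Collinear : ∀ {n} → Config n → Set
  Collinear P = ∃[ u ] ∃[ c ] ¬ u ≈ₚ (0# , 0#) × (∀ i → u ∙ P i ≈ c)

  OnCircle : Point → Carrier → Point → Set
  OnCircle o ρ p = (p -ₚ o) ∙ (p -ₚ o) ≈ ρ * ρ

  NoFourConcyclic : ∀ {n} → Config n → Set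
  NoFourConcyclic {n} P = ¬ (∃[ f ] Injective _≡_ _≡_ f ×
    (∃[ o ] ∃[ ρ ] 0# < ρ × (∀ (a : Fin 4) → OnCircle o ρ (P (f a)))))

  AngleValue : ∀ {n} → Config n → Carrier → Set
  AngleValue P θ =
    (∃[ π ] IsPi π × 0# < θ × θ < π) ×
    (∃[ i ] ∃[ j ] ∃[ k ] i ≢ j × j ≢ k × i ≢ k × IsAngle (P i) (P j) (P k) θ)

  -- IsA P k says that A(P) = k: the angle values of P can be listed, up to _≈_,
  -- as k pairwise distinct numbers.
  IsA : ∀ {n} → Config n → ℕ → Set
  IsA P k = ∃[ Θ ] Injective _≡_ _≈_ Θ ×
    (∀ (a : Fin k) → AngleValue P (Θ a)) ×
    (∀ θ → AngleValue P θ → ∃[ a ] θ ≈ Θ a)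

  Attained : ℕ → ℕ → Set
  Attained n k = ∃[ P ] Distinct {n} P × ¬ Collinear P × NoFourConcyclic P × IsA P k

  -- IsAno4c n m says that m is the minimum A_no4c(n).
  IsAno4c : ℕ → ℕ → Set
  IsAno4c n m = Attained n m × (∀ k → Attained n k → m ℕ.≤ k)

{-# OPTIONS --safe #-}
module Submission where

-- The configuration consists of p = (0,1) and of the points q k = (cot (kπ/n), 0)
-- for 0 < k < n.  The line through p and q k makes the angle kπ/n with the axis,
-- so the angles at p are differences of such angles, and the angle at q k facing
-- q l is kπ/n or (n - k)π/n according to whether k < l or l < k.  As the extreme
-- points q 1 and q (n - 1) have neighbours on one side only, (n - 1)π/n does not
-- occur.  A circle contains at most two points of the axis, hence at most three
-- points of the configuration.
--
-- Angles need not be constructed: the cosine is injective on (0,π), and the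
-- cosines of the angles take at most n - 2 values re k, the real parts of the
-- powers of a complex number with argument π/n, which is found algebraically.
-- Injectivity follows from d'Alembert's functional equation, a Cauchy product of
-- power series.

open import Level using (0ℓ)
open import Axiom.ExcludedMiddle using (ExcludedMiddle)
open import Algebra.Bundles using (Semiring)
open import Algebra.Solver.Ring.AlmostCommutativeRing using (fromCommutativeRing; _-Raw-AlmostCommutative⟶_)
open import Data.Empty using (⊥; ⊥-elim)
open import Data.Fin.Base as Fin using (Fin; toℕ; fromℕ<)
open import Data.Fin.Patterns using (0F; 1F; 2F; 3F)
import Data.Fin.Properties as Finₚ
open import Data.Integer.Base as ℤ using (ℤ; +_; -[1+_]; _⊖_)
import Data.Integer.Properties as ℤₚ
open import Data.Maybe.Base as Maybe using ()
open import Data.Nat.Base as ℕ using (ℕ; zero; suc; z≤n; s≤s; _!)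
import Data.Nat.Properties as ℕₚ
open import Data.Product.Base using (∃; ∃-syntax; _×_; _,_; proj₁; proj₂)
open import Data.Sum.Base using (_⊎_; inj₁; inj₂; [_,_]′)
open import Function.Base using (_∘_)
open import Function.Definitions using (Injective)
open import Relation.Binary.Bundles using (StrictTotalOrder; DecTotalOrder)
open import Relation.Binary.Definitions using (tri<; tri≈; tri>)
open import Relation.Binary.PropositionalEquality.Core as ≡ using (_≡_; _≢_)
open import Relation.Binary.Structures using (IsStrictTotalOrder)
open import Relation.Nullary.Decidable.Core using (yes; no; dec⇒maybe)
open import Relation.Nullary.Negation.Core using (¬_)
open import Defs

-- No relation between `re k` and the cosine of a multiple of π is ever proved. The configuration
-- uses only that z = `re 1` + `im 1` i has modulus 1, that z^k has positive imaginary part for 0 <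
-- k < n, and that z^n is real. Finding z is then an intermediate value problem for polynomials: if
-- t is the tangent of half the argument, z = ((1 - t²) + 2 t i)/(1 + t²), and the imaginary part of
-- z^k is a polynomial in t up to the factor 2 t/(1 + t²)^k. The least zero of the n-th polynomial
-- is the right t; Lipschitz bounds on [0,1] stand in for continuity.
--
-- An angle θ of the configuration comes with a number c such that cos θ = c and r s c = u ∙ v. So c
-- is found by algebra, and the cosine series enters only to show that c determines θ and that c² ≠
-- 1. The product of series requires absolute convergence, which is expressed by suprema of
-- nonnegative partial sums.

-- Ordered-field arithmetic and a ring solver with integer coefficients.

module OrderedField (R : RealNumbers) where
  open RealNumbers R public hiding (zero)
  open IsStrictTotalOrder isStrictTotalOrder public
    using (compare; <-respˡ-≈; <-respʳ-≈)
    renaming (trans to <-trans; irrefl to <-irrefl)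

  strictTotalOrder : StrictTotalOrder 0ℓ 0ℓ 0ℓ
  strictTotalOrder = record { isStrictTotalOrder = isStrictTotalOrder }

  open import Relation.Binary.Properties.StrictTotalOrder strictTotalOrder
    using (decTotalOrder)
  open DecTotalOrder decTotalOrder public
    using (≤-respˡ-≈; ≤-respʳ-≈)
    renaming (trans to ≤-trans; antisym to ≤-antisym; refl to ≤-refl)

  open import Algebra.Properties.Semiring.Mult semiring public
    using () renaming (_×_ to _•_; ×1-homo-* to •1-homo-*)
  open import Algebra.Definitions.RawSemiring (Semiring.rawSemiring semiring) public
    using (_^_; _×′_)
  open import Algebra.Properties.Semiring.Mult.TCOptimised semiring
    using (×-homo-+; ×1-homo-*; 1+×)
  open import Algebra.Properties.Ring ring public
    using (-0#≈0#; -‿involutive; -‿distribˡ-*; -‿distribʳ-*)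
  open import Algebra.Properties.AbelianGroup +-abelianGroup using (⁻¹-∙-comm)
  open import Relation.Binary.Reasoning.Setoid setoid

  -- With `_×′_` the numerals 1 and 2 compute to `1#` and `1# + 1#`, without a trailing `0#`, so the
  -- solver constants `:1` and `:2` are `1#` and `2#` definitionally.
  ⟦_⟧ : ℤ → Carrier
  ⟦ + n ⟧      = n ×′ 1#
  ⟦ -[1+ n ] ⟧ = - (suc n ×′ 1#)

  cancel-1 : ∀ x y → x - y ≈ (1# + x) - (1# + y)
  cancel-1 x y = begin
    x - y                     ≈⟨ +-congʳ (+-identityʳ x) ⟨
    (x + 0#) - y              ≈⟨ +-congʳ (+-congˡ (-‿inverseʳ 1#)) ⟨
    (x + (1# - 1#)) - y       ≈⟨ +-congʳ (+-assoc x 1# (- 1#)) ⟨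
    (x + 1# - 1#) - y         ≈⟨ +-assoc _ _ _ ⟩
    (x + 1#) + (- 1# - y)     ≈⟨ +-cong (+-comm x 1#) (⁻¹-∙-comm 1# y) ⟩
    (1# + x) - (1# + y)       ∎

  ⊖-homo : ∀ m n → ⟦ m ⊖ n ⟧ ≈ m ×′ 1# - n ×′ 1#
  ⊖-homo zero    zero    = sym (-‿inverseʳ 0#)
  ⊖-homo zero    (suc n) = sym (+-identityˡ _)
  ⊖-homo (suc m) zero    = sym (trans (+-congˡ -0#≈0#) (+-identityʳ _))
  ⊖-homo (suc m) (suc n) = begin
    ⟦ suc m ⊖ suc n ⟧                     ≡⟨ ≡.cong ⟦_⟧ (ℤₚ.[1+m]⊖[1+n]≡m⊖n m n) ⟩
    ⟦ m ⊖ n ⟧                             ≈⟨ ⊖-homo m n ⟩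
    m ×′ 1# - n ×′ 1#                     ≈⟨ cancel-1 _ _ ⟩
    (1# + m ×′ 1#) - (1# + n ×′ 1#)       ≈⟨ +-cong (1+× m 1#) (-‿cong (1+× n 1#)) ⟨
    suc m ×′ 1# - suc n ×′ 1#             ∎

  -‿homo : ∀ i → ⟦ ℤ.- i ⟧ ≈ - ⟦ i ⟧
  -‿homo (+ zero)   = sym -0#≈0#
  -‿homo (+ suc n)  = refl
  -‿homo (-[1+ n ]) = sym (-‿involutive _)

  +-homo : ∀ i j → ⟦ i ℤ.+ j ⟧ ≈ ⟦ i ⟧ + ⟦ j ⟧
  +-homo (+ m)    (+ n)    = ×-homo-+ 1# m n
  +-homo (+ m)    -[1+ n ] = ⊖-homo m (suc n)
  +-homo -[1+ m ] (+ n)    = trans (⊖-homo n (suc m)) (+-comm _ _)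
  +-homo -[1+ m ] -[1+ n ] = begin
    - (suc (suc (m ℕ.+ n)) ×′ 1#)          ≡⟨ ≡.cong (λ k → - (suc k ×′ 1#)) (ℕₚ.+-suc m n) ⟨
    - ((suc m ℕ.+ suc n) ×′ 1#)            ≈⟨ -‿cong (×-homo-+ 1# (suc m) (suc n)) ⟩
    - (suc m ×′ 1# + suc n ×′ 1#)          ≈⟨ ⁻¹-∙-comm _ _ ⟨
    - (suc m ×′ 1#) - suc n ×′ 1#          ∎

  +*-homo : ∀ m j → ⟦ + m ℤ.* j ⟧ ≈ ⟦ + m ⟧ * ⟦ j ⟧
  +*-homo m (+ n) = begin
    ⟦ + m ℤ.* + n ⟧     ≡⟨ ≡.cong ⟦_⟧ (ℤₚ.pos-* m n) ⟨
    (m ℕ.* n) ×′ 1#     ≈⟨ ×1-homo-* m n ⟩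
    m ×′ 1# * n ×′ 1#   ∎
  +*-homo m -[1+ n ] = begin
    ⟦ + m ℤ.* -[1+ n ] ⟧         ≡⟨ ≡.cong ⟦_⟧ (ℤₚ.neg-distribʳ-* (+ m) (+ suc n)) ⟨
    ⟦ ℤ.- (+ m ℤ.* + suc n) ⟧    ≈⟨ -‿homo (+ m ℤ.* + suc n) ⟩
    - ⟦ + m ℤ.* + suc n ⟧        ≈⟨ -‿cong (+*-homo m (+ suc n)) ⟩
    - (⟦ + m ⟧ * ⟦ + suc n ⟧)    ≈⟨ -‿distribʳ-* _ _ ⟩
    ⟦ + m ⟧ * ⟦ -[1+ n ] ⟧       ∎

  *-homo : ∀ i j → ⟦ i ℤ.* j ⟧ ≈ ⟦ i ⟧ * ⟦ j ⟧
  *-homo (+ m)    j = +*-homo m j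
  *-homo -[1+ m ] j = begin
    ⟦ -[1+ m ] ℤ.* j ⟧           ≡⟨ ≡.cong ⟦_⟧ (ℤₚ.neg-distribˡ-* (+ suc m) j) ⟨
    ⟦ ℤ.- (+ suc m ℤ.* j) ⟧      ≈⟨ -‿homo (+ suc m ℤ.* j) ⟩
    - ⟦ + suc m ℤ.* j ⟧          ≈⟨ -‿cong (+*-homo (suc m) j) ⟩
    - (⟦ + suc m ⟧ * ⟦ j ⟧)      ≈⟨ -‿distribˡ-* _ _ ⟩
    ⟦ -[1+ m ] ⟧ * ⟦ j ⟧         ∎

  ℤ⟶R : ℤ.+-*-rawRing -Raw-AlmostCommutative⟶ fromCommutativeRing commutativeRing
  ℤ⟶R = record
    { ⟦_⟧ = ⟦_⟧ ; +-homo = +-homo ; *-homo = *-homo ; -‿homo = -‿homo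
    ; 0-homo = refl ; 1-homo = refl }

  open import Algebra.Solver.Ring ℤ.+-*-rawRing (fromCommutativeRing commutativeRing) ℤ⟶R
    (λ i j → Maybe.map (λ eq → reflexive (≡.cong ⟦_⟧ eq)) (dec⇒maybe (i ℤₚ.≟ j)))
    public using (Polynomial; solve; _:=_; con; _:+_; _:*_; _:-_; :-_)

  :0 :1 :2 : ∀ {n} → Polynomial n
  :0 = con (+ 0)
  :1 = con (+ 1)
  :2 = con (+ 2)

  2# : Carrier
  2# = 1# + 1#

  1≉0 : ¬ 1# ≈ 0#
  1≉0 1≈0 = <-irrefl (sym 1≈0) 0<1

  <⇒≤ : ∀ {x y} → x < y → x ≤ y
  <⇒≤ = inj₁

  ≈⇒≤ : ∀ {x y} → x ≈ y → x ≤ y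
  ≈⇒≤ = inj₂

  <-≤-trans : ∀ {x y z} → x < y → y ≤ z → x < z
  <-≤-trans x<y (inj₁ y<z) = <-trans x<y y<z
  <-≤-trans x<y (inj₂ y≈z) = <-respʳ-≈ y≈z x<y

  ≤-<-trans : ∀ {x y z} → x ≤ y → y < z → x < z
  ≤-<-trans (inj₁ x<y) y<z = <-trans x<y y<z
  ≤-<-trans (inj₂ x≈y) y<z = <-respˡ-≈ (sym x≈y) y<z

  <⇒≱ : ∀ {x y} → x < y → ¬ y ≤ x
  <⇒≱ x<y y≤x = <-irrefl refl (<-≤-trans x<y y≤x)

  <⊎≥ : ∀ x y → x < y ⊎ y ≤ x
  <⊎≥ x y with compare x y
  ... | tri< x<y _ _ = inj₁ x<y
  ... | tri≈ _ x≈y _ = inj₂ (≈⇒≤ (sym x≈y))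
  ... | tri> _ _ y<x = inj₂ (<⇒≤ y<x)

  ≮⇒≥ : ∀ {x y} → ¬ x < y → y ≤ x
  ≮⇒≥ {x} {y} x≮y = [ (λ x<y → ⊥-elim (x≮y x<y)) , (λ y≤x → y≤x) ]′ (<⊎≥ x y)

  ≤∧≉⇒< : ∀ {x y} → x ≤ y → ¬ x ≈ y → x < y
  ≤∧≉⇒< (inj₁ x<y) _   = x<y
  ≤∧≉⇒< (inj₂ x≈y) x≉y = ⊥-elim (x≉y x≈y)

  x-y+y≈x : ∀ x y → x - y + y ≈ x
  x-y+y≈x = solve 2 (λ x y → x :- y :+ y := x) refl

  x<y⇒0<y-x : ∀ {x y} → x < y → 0# < y - x
  x<y⇒0<y-x {x} {y} x<y = <-respˡ-≈ (-‿inverseʳ x) (+-mono-< x y (- x) x<y)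

  x≤y⇒0≤y-x : ∀ {x y} → x ≤ y → 0# ≤ y - x
  x≤y⇒0≤y-x (inj₁ x<y) = inj₁ (x<y⇒0<y-x x<y)
  x≤y⇒0≤y-x (inj₂ x≈y) = inj₂ (sym (trans (+-congˡ (-‿cong x≈y)) (-‿inverseʳ _)))

  -- Inequalities are proved by exhibiting the difference of the two sides as
  -- a visibly nonnegative (or positive) expression.
  <-by : ∀ {x y e} → 0# < e → y - x ≈ e → x < y
  <-by {x} {y} 0<e y-x≈e =
    <-respˡ-≈ (+-identityˡ x) (<-respʳ-≈ (x-y+y≈x y x)
      (+-mono-< 0# (y - x) x (<-respʳ-≈ (sym y-x≈e) 0<e)))

  ≤-by : ∀ {x y e} → 0# ≤ e → y - x ≈ e → x ≤ y
  ≤-by         (inj₁ 0<e) y-x≈e = inj₁ (<-by 0<e y-x≈e)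
  ≤-by {x} {y} (inj₂ 0≈e) y-x≈e = inj₂ (trans (sym (+-identityˡ x))
    (trans (+-congʳ (trans 0≈e (sym y-x≈e))) (x-y+y≈x y x)))

  +-mono-≤ : ∀ {x y u v} → x ≤ y → u ≤ v → x + u ≤ y + v
  0≤+ : ∀ {x y} → 0# ≤ x → 0# ≤ y → 0# ≤ x + y

  0<+≤ : ∀ {x y} → 0# < x → 0# ≤ y → 0# < x + y
  0<+≤ {x} {y} 0<x 0≤y = ≤-<-trans 0≤y
    (<-by 0<x (solve 2 (λ x y → x :+ y :- y := x) refl x y))

  0<+ : ∀ {x y} → 0# < x → 0# < y → 0# < x + y
  0<+ 0<x 0<y = 0<+≤ 0<x (inj₁ 0<y)

  0≤+ (inj₁ 0<x) 0≤y = inj₁ (0<+≤ 0<x 0≤y)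
  0≤+ (inj₂ 0≈x) 0≤y = ≤-respʳ-≈ (trans (sym (+-identityˡ _)) (+-congʳ 0≈x)) 0≤y

  +-mono-≤ {x} {y} {u} {v} x≤y u≤v = ≤-by (0≤+ (x≤y⇒0≤y-x x≤y) (x≤y⇒0≤y-x u≤v))
    (solve 4 (λ x y u v → y :+ v :- (x :+ u) := y :- x :+ (v :- u)) refl x y u v)

  0≤* : ∀ {x y} → 0# ≤ x → 0# ≤ y → 0# ≤ x * y
  0≤* (inj₁ 0<x) (inj₁ 0<y) = inj₁ (*-pos _ _ 0<x 0<y)
  0≤* (inj₂ 0≈x) _          = inj₂ (sym (trans (*-congʳ (sym 0≈x)) (zeroˡ _)))
  0≤* _          (inj₂ 0≈y) = inj₂ (sym (trans (*-congˡ (sym 0≈y)) (zeroʳ _)))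

  *-monoˡ-≤ : ∀ {x y z} → 0# ≤ z → x ≤ y → z * x ≤ z * y
  *-monoˡ-≤ {x} {y} {z} 0≤z x≤y = ≤-by (0≤* 0≤z (x≤y⇒0≤y-x x≤y))
    (solve 3 (λ x y z → z :* y :- z :* x := z :* (y :- x)) refl x y z)

  *-monoˡ-< : ∀ {x y z} → 0# < z → x < y → z * x < z * y
  *-monoˡ-< {x} {y} {z} 0<z x<y = <-by (*-pos _ _ 0<z (x<y⇒0<y-x x<y))
    (solve 3 (λ x y z → z :* y :- z :* x := z :* (y :- x)) refl x y z)

  *-monoʳ-≤ : ∀ {x y z} → 0# ≤ z → x ≤ y → x * z ≤ y * z
  *-monoʳ-≤ {x} {y} {z} 0≤z x≤y = ≤-by (0≤* 0≤z (x≤y⇒0≤y-x x≤y))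
    (solve 3 (λ x y z → y :* z :- x :* z := z :* (y :- x)) refl x y z)

  *-mono-≤ : ∀ {x y u v} → 0# ≤ u → 0# ≤ y → x ≤ y → u ≤ v → x * u ≤ y * v
  *-mono-≤ 0≤u 0≤y x≤y u≤v = ≤-trans (*-monoʳ-≤ 0≤u x≤y) (*-monoˡ-≤ 0≤y u≤v)

  neg-flip : ∀ {x} → x < 0# → 0# < - x
  neg-flip {x} x<0 = <-respʳ-≈ (+-identityˡ (- x)) (x<y⇒0<y-x x<0)

  0≤x*x : ∀ x → 0# ≤ x * x
  0≤x*x x with compare 0# x
  ... | tri< 0<x _ _ = 0≤* (inj₁ 0<x) (inj₁ 0<x)
  ... | tri≈ _ 0≈x _ = 0≤* (inj₂ 0≈x) (inj₂ 0≈x)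
  ... | tri> _ _ x<0 = ≤-respʳ-≈ (solve 1 (λ x → (:- x) :* (:- x) := x :* x) refl x)
    (0≤* (inj₁ (neg-flip x<0)) (inj₁ (neg-flip x<0)))

  pos⇒≉0 : ∀ {x} → 0# < x → ¬ x ≈ 0#
  pos⇒≉0 0<x x≈0 = <-irrefl (sym x≈0) 0<x

  0<2 : 0# < 2#
  0<2 = 0<+ 0<1 0<1

  cancel-pos-≤ : ∀ {w x} → 0# < w → 0# ≤ w * x → 0# ≤ x
  cancel-pos-≤ 0<w 0≤wx = ≮⇒≥ λ x<0 →
    <⇒≱ (<-respʳ-≈ (zeroʳ _) (*-monoˡ-< 0<w x<0)) 0≤wx

  cancel-pos-< : ∀ {w x} → 0# < w → 0# < w * x → 0# < x
  cancel-pos-< {w} 0<w 0<wx = ≤∧≉⇒< (cancel-pos-≤ 0<w (<⇒≤ 0<wx))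
    λ 0≈x → <-irrefl (sym (trans (*-congˡ (sym 0≈x)) (zeroʳ w))) 0<wx

  ^-pos : ∀ {x} → 0# < x → ∀ n → 0# < x ^ n
  ^-pos 0<x zero    = 0<1
  ^-pos 0<x (suc n) = *-pos _ _ 0<x (^-pos 0<x n)

  *-cancelˡ : ∀ {x y z} → ¬ x ≈ 0# → x * y ≈ x * z → y ≈ z
  *-cancelˡ {x} {y} {z} x≉0 xy≈xz = begin
    y                  ≈⟨ undo y ⟨
    x ⁻¹ * (x * y)     ≈⟨ *-congˡ xy≈xz ⟩
    x ⁻¹ * (x * z)     ≈⟨ undo z ⟩
    z                  ∎
    where
    undo : ∀ w → x ⁻¹ * (x * w) ≈ w
    undo w = begin
      x ⁻¹ * (x * w)   ≈⟨ *-assoc _ _ _ ⟨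
      x ⁻¹ * x * w     ≈⟨ *-congʳ (trans (*-comm _ _) (inverse x x≉0)) ⟩
      1# * w           ≈⟨ *-identityˡ w ⟩
      w                ∎

  zero-product : ∀ {x y} → x * y ≈ 0# → x ≈ 0# ⊎ y ≈ 0#
  zero-product {x} {y} xy≈0 with compare x 0#
  ... | tri< _ x≉0 _ = inj₂ (*-cancelˡ x≉0 (trans xy≈0 (sym (zeroʳ x))))
  ... | tri≈ _ x≈0 _ = inj₁ x≈0
  ... | tri> _ x≉0 _ = inj₂ (*-cancelˡ x≉0 (trans xy≈0 (sym (zeroʳ x))))

  x-y≈0⇒x≈y : ∀ {x y} → x - y ≈ 0# → x ≈ y
  x-y≈0⇒x≈y {x} {y} x-y≈0 =
    trans (sym (x-y+y≈x x y)) (trans (+-congʳ x-y≈0) (+-identityˡ y))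

  x≈y⇒x-y≈0 : ∀ {x y} → x ≈ y → x - y ≈ 0#
  x≈y⇒x-y≈0 {x} {y} x≈y = trans (+-congʳ x≈y) (-‿inverseʳ y)

  ≈-by : ∀ {x y u v} → u ≈ v → x - y ≈ u - v → x ≈ y
  ≈-by u≈v x-y≈u-v = x-y≈0⇒x≈y (trans x-y≈u-v (x≈y⇒x-y≈0 u≈v))

  square-injective : ∀ {x y} → x * x ≈ y * y → x ≈ y ⊎ x ≈ - y
  square-injective {x} {y} xx≈yy
    with zero-product (trans (solve 2 (λ x y → (x :- y) :* (x :+ y) := x :* x :- y :* y) refl x y)
                             (x≈y⇒x-y≈0 xx≈yy))
  ... | inj₁ x-y≈0 = inj₁ (x-y≈0⇒x≈y x-y≈0)
  ... | inj₂ x+y≈0 = inj₂ (≈-by x+y≈0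
    (solve 2 (λ x y → x :- :- y := x :+ y :- :0) refl x y))

  square≈1 : ∀ {x} → x * x ≈ 1# → x ≈ 1# ⊎ x ≈ - 1#
  square≈1 xx≈1 = square-injective (trans xx≈1 (sym (*-identityˡ 1#)))

  square-injective-≥0 : ∀ {x y} → 0# ≤ x → 0# < y → x * x ≈ y * y → x ≈ y
  square-injective-≥0 {x} {y} 0≤x 0<y xx≈yy with square-injective xx≈yy
  ... | inj₁ x≈y  = x≈y
  ... | inj₂ x≈-y = ⊥-elim (<-irrefl (sym (trans (+-congˡ x≈-y) (-‿inverseʳ y))) (0<+≤ 0<y 0≤x))

  ⁻¹-pos : ∀ {x} → 0# < x → 0# < x ⁻¹
  ⁻¹-pos {x} 0<x with <⊎≥ 0# (x ⁻¹)
  ... | inj₁ 0<x⁻¹ = 0<x⁻¹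
  ... | inj₂ x⁻¹≤0 = ⊥-elim (<⇒≱ 0<1 (≤-respˡ-≈ (inverse x (pos⇒≉0 0<x))
          (≤-respʳ-≈ (zeroʳ x) (*-monoˡ-≤ (<⇒≤ 0<x) x⁻¹≤0))))

  ⁻¹-unique : ∀ {x y} → x * y ≈ 1# → y ≈ x ⁻¹
  ⁻¹-unique {x} {y} xy≈1 = *-cancelˡ x≉0 (trans xy≈1 (sym (inverse x x≉0)))
    where
    x≉0 : ¬ x ≈ 0#
    x≉0 x≈0 = 1≉0 (trans (sym xy≈1) (trans (*-congʳ x≈0) (zeroˡ y)))

  ½ : Carrier
  ½ = 2# ⁻¹

  2*½ : 2# * ½ ≈ 1#
  2*½ = inverse 2# (pos⇒≉0 0<2)

  half-sum : ∀ x → x * ½ + x * ½ ≈ x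
  half-sum x = trans (solve 2 (λ x h → x :* h :+ x :* h := x :* (:2 :* h)) refl x ½)
    (trans (*-congˡ 2*½) (*-identityʳ x))

  half-pos : ∀ {x} → 0# < x → 0# < x * ½
  half-pos 0<x = *-pos _ _ 0<x (⁻¹-pos 0<2)

  double-nonneg : ∀ {x} → 0# ≤ x + x → 0# ≤ x
  double-nonneg {x} 0≤x+x = ≤-respʳ-≈ (trans (distribʳ ½ x x) (half-sum x))
    (0≤* 0≤x+x (<⇒≤ (⁻¹-pos 0<2)))

  double-injective : ∀ {x y} → x + x ≈ y + y → x ≈ y
  double-injective {x} {y} x+x≈y+y = *-cancelˡ (pos⇒≉0 0<2)
    (trans (solve 1 (λ x → :2 :* x := x :+ x) refl x)
      (trans x+x≈y+y (solve 1 (λ x → x :+ x := :2 :* x) refl y)))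

  ι : ℕ → Carrier
  ι n = n • 1#

  ι-nonneg : ∀ n → 0# ≤ ι n
  ι-nonneg zero    = ≤-refl
  ι-nonneg (suc n) = 0≤+ (<⇒≤ 0<1) (ι-nonneg n)

  ι-pos : ∀ n → 0# < ι (suc n)
  ι-pos n = 0<+≤ 0<1 (ι-nonneg n)

  -- Otherwise the numbers `ι n` have a supremum s, and `ι (suc n)` ≤ s for all n makes s - 1 a
  -- smaller upper bound.
  archimedean : ExcludedMiddle 0ℓ → ∀ x → ∃[ n ] x < ι n
  archimedean em x with em {∃[ n ] x < ι n}
  ... | yes x<ιn = x<ιn
  ... | no  x≮ιn = ⊥-elim (<⇒≱ s-1<s (least (s - 1#) λ y (n , y≈ιn) →
          ≤-respˡ-≈ (sym y≈ιn) (≤-by (x≤y⇒0≤y-x (above (ι (suc n)) (suc n , refl)))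
            (solve 2 (λ s i → s :- :1 :- i := s :- (:1 :+ i)) refl s (ι n)))))
    where
    Values : Carrier → Set
    Values y = ∃[ n ] y ≈ ι n
    sup : ∃[ s ] IsUpperBound Values s × (∀ b → IsUpperBound Values b → s ≤ b)
    sup = complete Values (0# , 0 , refl)
      (x , λ y (n , y≈ιn) → ≤-respˡ-≈ (sym y≈ιn) (≮⇒≥ λ x<ιn → x≮ιn (n , x<ιn)))
    s     = proj₁ sup
    above = proj₁ (proj₂ sup)
    least = proj₂ (proj₂ sup)
    s-1<s : s - 1# < s
    s-1<s = <-by 0<1 (solve 1 (λ s → s :- (s :- :1) := :1) refl s)

-- Absolutely convergent series and their Cauchy product.

module Series (R : RealNumbers) where
  open OrderedField R
  open Analysis R
  open import Algebra.Properties.Semiring.Sum semiring using (sum-syntax)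
  open import Relation.Binary.Reasoning.Setoid setoid

  Seq : Set
  Seq = ℕ → Carrier

  -- Sums and Cauchy products unfold at index 0, so inductions on the length pass to the shifted
  -- sequence.
  shift : Seq → Seq
  shift a k = a (suc k)

  Σ : Seq → ℕ → Carrier
  Σ a m = ∑[ k < m ] a (toℕ k)

  Nonneg : Seq → Set
  Nonneg a = ∀ k → 0# ≤ a k

  Σ-cong : ∀ {a b} → (∀ k → a k ≈ b k) → ∀ m → Σ a m ≈ Σ b m
  Σ-cong a≈b zero    = refl
  Σ-cong a≈b (suc m) = +-cong (a≈b 0) (Σ-cong (a≈b ∘ suc) m)

  Σ-+ : ∀ a b m → Σ (λ k → a k + b k) m ≈ Σ a m + Σ b m
  Σ-+ a b zero    = sym (+-identityˡ 0#)
  Σ-+ a b (suc m) = trans (+-congˡ (Σ-+ (shift a) (shift b) m))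
    (solve 4 (λ x y s t → x :+ y :+ (s :+ t) := x :+ s :+ (y :+ t)) refl
      (a 0) (b 0) (Σ (shift a) m) (Σ (shift b) m))

  Σ-scale : ∀ c a m → Σ (λ k → c * a k) m ≈ c * Σ a m
  Σ-scale c a zero    = sym (zeroʳ c)
  Σ-scale c a (suc m) = trans (+-congˡ (Σ-scale c (shift a) m)) (sym (distribˡ c _ _))

  Σ-sub : ∀ a b m → Σ (λ k → a k - b k) m ≈ Σ a m - Σ b m
  Σ-sub a b zero    = sym (-‿inverseʳ 0#)
  Σ-sub a b (suc m) = trans (+-congˡ (Σ-sub (shift a) (shift b) m))
    (solve 4 (λ x y s t → x :- y :+ (s :- t) := x :+ s :- (y :+ t)) refl
      (a 0) (b 0) (Σ (shift a) m) (Σ (shift b) m))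

  Σ-nonneg : ∀ {a} → Nonneg a → ∀ m → 0# ≤ Σ a m
  Σ-nonneg 0≤a zero    = ≤-refl
  Σ-nonneg 0≤a (suc m) = 0≤+ (0≤a 0) (Σ-nonneg (0≤a ∘ suc) m)

  Σ-mono : ∀ {a} → Nonneg a → ∀ {m n} → m ℕ.≤ n → Σ a m ≤ Σ a n
  Σ-mono 0≤a {n = n} z≤n   = Σ-nonneg 0≤a n
  Σ-mono 0≤a (s≤s m≤n) = +-mono-≤ ≤-refl (Σ-mono (0≤a ∘ suc) m≤n)

  Σ-last : ∀ a m → Σ a (suc m) ≈ Σ a m + a m
  Σ-last a zero    = +-comm (a 0) 0#
  Σ-last a (suc m) = trans (+-congˡ (Σ-last (shift a) m)) (sym (+-assoc _ _ _))

  IsSup : Seq → Carrier → Set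
  IsSup s A = (∀ m → s m ≤ A) × (∀ b → (∀ m → s m ≤ b) → A ≤ b)

  sup-exists : ∀ s b → (∀ m → s m ≤ b) → ∃ (IsSup s)
  sup-exists s b s≤b with complete (λ y → ∃[ m ] y ≈ s m) (s 0 , 0 , refl)
                            (b , λ y (m , y≈sm) → ≤-respˡ-≈ (sym y≈sm) (s≤b m))
  ... | A , above , least = A , (λ m → above (s m) (m , refl)) ,
          λ c s≤c → least c λ y (m , y≈sm) → ≤-respˡ-≈ (sym y≈sm) (s≤c m)

  sup-unique : ∀ {s t A B} → (∀ m → s m ≈ t m) → IsSup s A → IsSup t B → A ≈ B
  sup-unique s≈t (s≤A , A≤) (t≤B , B≤) = ≤-antisym
    (A≤ _ λ m → ≤-respˡ-≈ (sym (s≈t m)) (t≤B m)) (B≤ _ λ m → ≤-respˡ-≈ (s≈t m) (s≤A m))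

  record NonnegSum (u : Seq) (U : Carrier) : Set where
    field
      nonneg : Nonneg u
      isSup  : IsSup (Σ u) U

    ≤sum : ∀ m → Σ u m ≤ U
    ≤sum = proj₁ isSup

    least : ∀ b → (∀ m → Σ u m ≤ b) → U ≤ b
    least = proj₂ isSup

    sum-nonneg : 0# ≤ U
    sum-nonneg = ≤sum 0

  open NonnegSum

  ≤-move : ∀ {x y z} → x + y ≤ z → x ≤ z - y
  ≤-move {x} {y} {z} x+y≤z = ≤-by (x≤y⇒0≤y-x x+y≤z)
    (solve 3 (λ x y z → z :- y :- x := z :- (x :+ y)) refl x y z)

  ≤-unmove : ∀ {x y z} → x ≤ z - y → x + y ≤ z
  ≤-unmove {x} {y} {z} x≤z-y = ≤-by (x≤y⇒0≤y-x x≤z-y)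
    (solve 3 (λ x y z → z :- (x :+ y) := z :- y :- x) refl x y z)

  -- For leastness the two suprema are taken one after the other: `Σ u p` + `Σ v q` is at most the
  -- partial sum of length p + q, since the terms are nonnegative.
  nonnegSum-+ : ∀ {u v U V} → NonnegSum u U → NonnegSum v V →
                NonnegSum (λ k → u k + v k) (U + V)
  nonnegSum-+ {u} {v} {U} {V} su sv = record
    { nonneg = λ k → 0≤+ (nonneg su k) (nonneg sv k)
    ; isSup  = (λ m → ≤-respˡ-≈ (sym (Σ-+ u v m)) (+-mono-≤ (≤sum su m) (≤sum sv m)))
             , λ b Σ≤b → ≤-unmove (least su _ λ p → ≤-move (≤-respˡ-≈ (+-comm V _)
                 (≤-unmove (least sv _ λ q → ≤-move (≤-trans (≤-respˡ-≈ (+-comm _ _)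
                   (+-mono-≤ (Σ-mono (nonneg su) (ℕₚ.m≤m+n p q))
                             (Σ-mono (nonneg sv) (ℕₚ.m≤n+m q p))))
                   (≤-respˡ-≈ (Σ-+ u v (p ℕ.+ q)) (Σ≤b (p ℕ.+ q))))))))
    }

  -- The Cauchy product: `conv a b n` is the sum of a i * b j over i + j = n.
  conv : Seq → Seq → Seq
  conv a b zero    = a 0 * b 0
  conv a b (suc n) = a 0 * b (suc n) + conv (shift a) b n

  conv-cong : ∀ {a a′ b b′} → (∀ k → a k ≈ a′ k) → (∀ k → b k ≈ b′ k) →
              ∀ n → conv a b n ≈ conv a′ b′ n
  conv-cong a≈ b≈ zero    = *-cong (a≈ 0) (b≈ 0)
  conv-cong a≈ b≈ (suc n) = +-cong (*-cong (a≈ 0) (b≈ (suc n))) (conv-cong (a≈ ∘ suc) b≈ n)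

  conv-nonneg : ∀ {a b} → Nonneg a → Nonneg b → Nonneg (conv a b)
  conv-nonneg 0≤a 0≤b zero    = 0≤* (0≤a 0) (0≤b 0)
  conv-nonneg 0≤a 0≤b (suc n) =
    0≤+ (0≤* (0≤a 0) (0≤b (suc n))) (conv-nonneg (0≤a ∘ suc) 0≤b n)

  conv-+ˡ : ∀ a a′ b n → conv (λ k → a k + a′ k) b n ≈ conv a b n + conv a′ b n
  conv-+ˡ a a′ b zero    = distribʳ _ _ _
  conv-+ˡ a a′ b (suc n) = trans (+-congˡ (conv-+ˡ (shift a) (shift a′) b n))
    (solve 5 (λ x x′ y s t → (x :+ x′) :* y :+ (s :+ t) := x :* y :+ s :+ (x′ :* y :+ t))
      refl (a 0) (a′ 0) (b (suc n)) _ _)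

  conv-+ʳ : ∀ a b b′ n → conv a (λ k → b k + b′ k) n ≈ conv a b n + conv a b′ n
  conv-+ʳ a b b′ zero    = distribˡ _ _ _
  conv-+ʳ a b b′ (suc n) = trans (+-congˡ (conv-+ʳ (shift a) b b′ n))
    (solve 5 (λ x y y′ s t → x :* (y :+ y′) :+ (s :+ t) := x :* y :+ s :+ (x :* y′ :+ t))
      refl (a 0) (b (suc n)) (b′ (suc n)) _ _)

  conv-scaleˡ : ∀ c a b n → conv (λ k → c * a k) b n ≈ c * conv a b n
  conv-scaleˡ c a b zero    = *-assoc _ _ _
  conv-scaleˡ c a b (suc n) = trans (+-cong (*-assoc _ _ _) (conv-scaleˡ c (shift a) b n))
    (sym (distribˡ _ _ _))

  conv-scaleʳ : ∀ c a b n → conv a (λ k → c * b k) n ≈ c * conv a b n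
  conv-scaleʳ c a b zero    = solve 3 (λ x y c → x :* (c :* y) := c :* (x :* y)) refl _ _ _
  conv-scaleʳ c a b (suc n) = trans (+-congˡ (conv-scaleʳ c (shift a) b n))
    (solve 4 (λ x y c t → x :* (c :* y) :+ c :* t := c :* (x :* y :+ t))
      refl (a 0) (b (suc n)) c _)

  conv-sub : ∀ a u v b u′ v′ → (∀ k → a k ≈ u k - v k) → (∀ k → b k ≈ u′ k - v′ k) →
    ∀ n → conv a b n ≈ conv u u′ n + conv v v′ n - (conv u v′ n + conv v u′ n)
  conv-sub a u v b u′ v′ a≈ b≈ zero = trans (*-cong (a≈ 0) (b≈ 0))
    (solve 4 (λ u v u′ v′ → (u :- v) :* (u′ :- v′) :=
        u :* u′ :+ v :* v′ :- (u :* v′ :+ v :* u′)) refl (u 0) (v 0) (u′ 0) (v′ 0))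
  conv-sub a u v b u′ v′ a≈ b≈ (suc n) =
    trans (+-cong (*-cong (a≈ 0) (b≈ (suc n)))
                  (conv-sub (shift a) (shift u) (shift v) b u′ v′ (a≈ ∘ suc) b≈ n))
    (solve 8 (λ u v u′ v′ p q r s → (u :- v) :* (u′ :- v′) :+ (p :+ q :- (r :+ s)) :=
        u :* u′ :+ p :+ (v :* v′ :+ q) :- (u :* v′ :+ r :+ (v :* u′ :+ s))) refl
      (u 0) (v 0) (u′ (suc n)) (v′ (suc n)) _ _ _ _)

  Σ-conv-step : ∀ u v m → Σ (conv u v) (suc m) ≈ u 0 * Σ v (suc m) + Σ (conv (shift u) v) m
  Σ-conv-step u v m = begin
    u 0 * v 0 + Σ (λ k → u 0 * v (suc k) + conv (shift u) v k) m
      ≈⟨ +-congˡ (trans (Σ-+ (λ k → u 0 * v (suc k)) (conv (shift u) v) m)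
                        (+-congʳ (Σ-scale (u 0) (shift v) m))) ⟩
    u 0 * v 0 + (u 0 * Σ (shift v) m + Σ (conv (shift u) v) m)
      ≈⟨ solve 4 (λ x y s t → x :* y :+ (x :* s :+ t) := x :* (y :+ s) :+ t) refl _ _ _ _ ⟩
    u 0 * Σ v (suc m) + Σ (conv (shift u) v) m  ∎

  -- The triangle i + j < m lies in the square i, j < m.
  Σ-conv-≤ : ∀ {u v} → Nonneg u → Nonneg v → ∀ m → Σ (conv u v) m ≤ Σ u m * Σ v m
  Σ-conv-≤ 0≤u 0≤v zero = ≈⇒≤ (sym (zeroˡ 0#))
  Σ-conv-≤ {u} {v} 0≤u 0≤v (suc m) = ≤-respˡ-≈ (sym (Σ-conv-step u v m))
    (≤-respʳ-≈ (sym (distribʳ _ _ _)) (+-mono-≤ ≤-refl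
      (≤-trans (Σ-conv-≤ (0≤u ∘ suc) 0≤v m)
        (*-monoˡ-≤ (Σ-nonneg (0≤u ∘ suc) m) (Σ-mono 0≤v (ℕₚ.n≤1+n m))))))

  -- The rectangle i < p, j < q lies in the triangle i + j < p + q. Together with the previous bound
  -- this identifies the supremum of the triangular sums.
  Σ-conv-≥ : ∀ {u v} → Nonneg u → Nonneg v → ∀ p q → Σ u p * Σ v q ≤ Σ (conv u v) (p ℕ.+ q)
  Σ-conv-≥ 0≤u 0≤v zero    q = ≤-respˡ-≈ (sym (zeroˡ _)) (Σ-nonneg (conv-nonneg 0≤u 0≤v) q)
  Σ-conv-≥ {u} {v} 0≤u 0≤v (suc p) q = ≤-respʳ-≈ (sym (Σ-conv-step u v (p ℕ.+ q)))
    (≤-respˡ-≈ (sym (distribʳ _ _ _)) (+-mono-≤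
      (*-monoˡ-≤ (0≤u 0) (Σ-mono 0≤v (ℕₚ.m≤n+m q (suc p))))
      (Σ-conv-≥ (0≤u ∘ suc) 0≤v p q)))

  -- For positive c divide by c; for c = 0 the claim is `0# ≤ b`.
  ≤-of-scaled-sup : ∀ {s A c b} → IsSup s A → 0# ≤ b → 0# ≤ c → (∀ m → c * s m ≤ b) → c * A ≤ b
  ≤-of-scaled-sup {s} {A} {c} {b} sup 0≤b (inj₂ 0≈c) cs≤b =
    ≤-respˡ-≈ (sym (trans (*-congʳ (sym 0≈c)) (zeroˡ A))) 0≤b
  ≤-of-scaled-sup {s} {A} {c} {b} (_ , A≤) 0≤b (inj₁ 0<c) cs≤b = ≤-respʳ-≈ (c*[c⁻¹*x]≈x b)
    (*-monoˡ-≤ (inj₁ 0<c) (A≤ (c ⁻¹ * b) λ m → ≤-respˡ-≈ (c⁻¹*[c*x]≈x (s m))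
      (*-monoˡ-≤ (inj₁ (⁻¹-pos 0<c)) (cs≤b m))))
    where
    c*[c⁻¹*x]≈x : ∀ x → c * (c ⁻¹ * x) ≈ x
    c*[c⁻¹*x]≈x x = trans (sym (*-assoc _ _ _))
      (trans (*-congʳ (inverse c (pos⇒≉0 0<c))) (*-identityˡ x))
    c⁻¹*[c*x]≈x : ∀ x → c ⁻¹ * (c * x) ≈ x
    c⁻¹*[c*x]≈x x = trans (solve 3 (λ c d x → d :* (c :* x) := c :* (d :* x)) refl c (c ⁻¹) x)
      (c*[c⁻¹*x]≈x x)

  nonnegSum-conv : ∀ {u v U V} → NonnegSum u U → NonnegSum v V → NonnegSum (conv u v) (U * V)
  nonnegSum-conv {u} {v} {U} {V} su sv = record
    { nonneg = conv-nonneg (nonneg su) (nonneg sv)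
    ; isSup  = (λ m → ≤-trans (Σ-conv-≤ (nonneg su) (nonneg sv) m)
                 (*-mono-≤ (Σ-nonneg (nonneg sv) m) (sum-nonneg su) (≤sum su m) (≤sum sv m)))
             , λ b Σ≤b → ≤-respˡ-≈ (*-comm V U) (≤-of-scaled-sup (isSup su) (Σ≤b 0) (sum-nonneg sv)
                 λ p → ≤-respˡ-≈ (*-comm _ V) (≤-of-scaled-sup (isSup sv) (Σ≤b 0)
                   (Σ-nonneg (nonneg su) p)
                   λ q → ≤-trans (Σ-conv-≥ (nonneg su) (nonneg sv) p q) (Σ≤b (p ℕ.+ q))))
    }

  -- Absolute convergence, with the sum: a is a difference of two summable
  -- nonnegative series, so that sums are governed by suprema alone.
  record AbsSum (a : Seq) (A : Carrier) : Set where
    field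
      {u v} : Seq
      {U V} : Carrier
      split : ∀ k → a k ≈ u k - v k
      sumᵘ  : NonnegSum u U
      sumᵛ  : NonnegSum v V
      value : A ≈ U - V

  open AbsSum

  -- The sum does not depend on the splitting: u - v = u′ - v′ gives u + v′ = u′ + v termwise, and
  -- these are nonnegative series with unique suprema.
  absSum-unique : ∀ {a b A B} → (∀ k → a k ≈ b k) → AbsSum a A → AbsSum b B → A ≈ B
  absSum-unique a≈b sa sb = trans (value sa) (trans (≈-by U+V′≈U′+V
      (solve 4 (λ x y z w → x :- y :- (z :- w) := x :+ w :- (z :+ y)) refl _ _ _ _))
      (sym (value sb)))
    where
    U+V′≈U′+V = sup-unique
      (Σ-cong λ k → ≈-by (trans (sym (split sa k)) (trans (a≈b k) (split sb k)))
         (solve 4 (λ x y z w → x :+ w :- (z :+ y) := x :- y :- (z :- w)) refl _ _ _ _))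
      (isSup (nonnegSum-+ (sumᵘ sa) (sumᵛ sb))) (isSup (nonnegSum-+ (sumᵘ sb) (sumᵛ sa)))

  absSum-+ : ∀ {a b A B} → AbsSum a A → AbsSum b B → AbsSum (λ k → a k + b k) (A + B)
  absSum-+ sa sb = record
    { split = λ k → trans (+-cong (split sa k) (split sb k)) (interchange _ _ _ _)
    ; sumᵘ  = nonnegSum-+ (sumᵘ sa) (sumᵘ sb)
    ; sumᵛ  = nonnegSum-+ (sumᵛ sa) (sumᵛ sb)
    ; value = trans (+-cong (value sa) (value sb)) (interchange _ _ _ _)
    }
    where
    interchange : ∀ x y z w → x - y + (z - w) ≈ x + z - (y + w)
    interchange = solve 4 (λ x y z w → x :- y :+ (z :- w) := x :+ z :- (y :+ w)) refl

  absSum-conv : ∀ {a b A B} → AbsSum a A → AbsSum b B → AbsSum (conv a b) (A * B)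
  absSum-conv {a} {b} sa sb = record
    { split = conv-sub a (u sa) (v sa) b (u sb) (v sb) (split sa) (split sb)
    ; sumᵘ  = nonnegSum-+ (nonnegSum-conv (sumᵘ sa) (sumᵘ sb)) (nonnegSum-conv (sumᵛ sa) (sumᵛ sb))
    ; sumᵛ  = nonnegSum-+ (nonnegSum-conv (sumᵘ sa) (sumᵛ sb)) (nonnegSum-conv (sumᵛ sa) (sumᵘ sb))
    ; value = trans (*-cong (value sa) (value sb))
        (solve 4 (λ u v u′ v′ → (u :- v) :* (u′ :- v′) :=
          u :* u′ :+ v :* v′ :- (u :* v′ :+ v :* u′)) refl _ _ _ _)
    }

  -- If |a| ≤ p, then a = (a + p) - p is a difference of nonnegative series, with partial sums at
  -- most 2b and b.
  dominated : ∀ a p b → (∀ k → 0# ≤ p k) → (∀ k → 0# ≤ a k + p k) → (∀ k → a k ≤ p k) →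
              (∀ m → Σ p m ≤ b) → ∃ (AbsSum a)
  dominated a p b 0≤p 0≤a+p a≤p Σp≤b = proj₁ supᵘ - proj₁ supᵛ , record
    { split = λ k → solve 2 (λ x y → x := x :+ y :- y) refl (a k) (p k)
    ; sumᵘ  = record { nonneg = 0≤a+p ; isSup = proj₂ supᵘ }
    ; sumᵛ  = record { nonneg = 0≤p ; isSup = proj₂ supᵛ }
    ; value = refl
    }
    where
    Σa≤Σp : ∀ {a p} → (∀ k → a k ≤ p k) → ∀ m → Σ a m ≤ Σ p m
    Σa≤Σp a≤p zero    = ≤-refl
    Σa≤Σp a≤p (suc m) = +-mono-≤ (a≤p 0) (Σa≤Σp (a≤p ∘ suc) m)
    supᵛ = sup-exists (Σ p) b Σp≤b
    supᵘ = sup-exists (Σ λ k → a k + p k) (b + b) λ m → ≤-respˡ-≈ (sym (Σ-+ a p m))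
      (+-mono-≤ (≤-trans (Σa≤Σp a≤p m) (Σp≤b m)) (Σp≤b m))

  x-ε<x : ∀ x {ε} → 0# < ε → x - ε < x
  x-ε<x x {ε} 0<ε = <-by 0<ε (solve 2 (λ x e → x :- (x :- e) := e) refl x ε)

  approach : ExcludedMiddle 0ℓ → ∀ {u U ε} → NonnegSum u U → 0# < ε →
             ∃[ N ] ∀ m → N ℕ.≤ m → U - ε < Σ u m
  approach em {u} {U} {ε} su 0<ε with em {∃[ N ] U - ε < Σ u N}
  ... | yes (N , U-ε<) = N , λ m N≤m → <-≤-trans U-ε< (Σ-mono (nonneg su) N≤m)
  ... | no ¬∃ = ⊥-elim (<⇒≱ (x-ε<x U 0<ε)
                  (least su (U - ε) λ m → ≮⇒≥ λ U-ε< → ¬∃ (m , U-ε<)))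

  -- Partial sums of u and v approach U and V from below, so the errors are one-sided. Each
  -- inequality uses the approximation of only one of the two series, and ε need not be halved.
  absSum⇒Converges : ExcludedMiddle 0ℓ → ∀ {a A} → AbsSum a A → Converges (Σ a) A
  absSum⇒Converges em {a} {A} sa ε 0<ε =
    let N  , u> = approach em (sumᵘ sa) 0<ε
        N′ , v> = approach em (sumᵛ sa) 0<ε
        Σa≈ = λ m → trans (Σ-cong (split sa) m) (Σ-sub (u sa) (v sa) m)
    in N ℕ.+ N′ , λ m N+N′≤m →
      <-by (0<+≤ (x<y⇒0<y-x (u> m (ℕₚ.≤-trans (ℕₚ.m≤m+n N N′) N+N′≤m)))
                 (x≤y⇒0≤y-x (≤sum (sumᵛ sa) m)))
        (trans (+-cong (Σa≈ m) (-‿cong (+-congʳ (value sa))))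
          (solve 5 (λ s t x y e → s :- t :- (x :- y :- e) := s :- (x :- e) :+ (y :- t))
            refl _ _ _ _ ε)) ,
      <-by (0<+≤ (x<y⇒0<y-x (v> m (ℕₚ.≤-trans (ℕₚ.m≤n+m N′ N) N+N′≤m)))
                 (x≤y⇒0≤y-x (≤sum (sumᵘ sa) m)))
        (trans (+-cong (+-congʳ (value sa)) (-‿cong (Σa≈ m)))
          (solve 5 (λ s t x y e → x :- y :+ e :- (s :- t) := t :- (y :- e) :+ (x :- s))
            refl _ _ _ _ ε))

  limit-≤ : ∀ {s l b} N → Converges s l → (∀ m → N ℕ.≤ m → s m ≤ b) → l ≤ b
  limit-≤ {s} {l} {b} N conv s≤b = ≮⇒≥ λ b<l →
    let N′ , close = conv (l - b) (x<y⇒0<y-x b<l)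
        l-[l-b]<s  = proj₁ (close (N ℕ.+ N′) (ℕₚ.m≤n+m N′ N))
    in <⇒≱ (<-respˡ-≈ (solve 2 (λ l b → l :- (l :- b) := b) refl l b) l-[l-b]<s)
           (s≤b (N ℕ.+ N′) (ℕₚ.m≤m+n N N′))

  limit-≥ : ∀ {s l b} N → Converges s l → (∀ m → N ℕ.≤ m → b ≤ s m) → b ≤ l
  limit-≥ {s} {l} {b} N conv b≤s = ≮⇒≥ λ l<b →
    let N′ , close = conv (b - l) (x<y⇒0<y-x l<b)
        s<l+[b-l]  = proj₂ (close (N ℕ.+ N′) (ℕₚ.m≤n+m N′ N))
    in <⇒≱ (<-respʳ-≈ (solve 2 (λ l b → l :+ (b :- l) := b) refl l b) s<l+[b-l])
           (b≤s (N ℕ.+ N′) (ℕₚ.m≤m+n N N′))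

  limit-unique-≤ : ∀ {s l l′} → Converges s l → Converges s l′ → l ≤ l′
  limit-unique-≤ {s} {l} {l′} c c′ = ≮⇒≥ λ l′<l →
    let ε = (l - l′) * ½
        0<ε = half-pos (x<y⇒0<y-x l′<l)
        N , close   = c ε 0<ε
        N′ , close′ = c′ ε 0<ε
        m = N ℕ.+ N′
    in <-irrefl refl (<-trans (proj₁ (close m (ℕₚ.m≤m+n N N′)))
         (<-respʳ-≈ (≈-by (half-sum (l - l′))
             (solve 3 (λ l l′ e → l′ :+ e :- (l :- e) := e :+ e :- (l :- l′)) refl l l′ ε))
           (proj₂ (close′ m (ℕₚ.m≤n+m N′ N)))))

  limit-unique : ∀ {s l l′} → Converges s l → Converges s l′ → l ≈ l′
  limit-unique c c′ = ≤-antisym (limit-unique-≤ c c′) (limit-unique-≤ c′ c)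

  converges-resp-≈ : ∀ {s l l′} → l ≈ l′ → Converges s l → Converges s l′
  converges-resp-≈ l≈l′ c ε 0<ε = let N , close = c ε 0<ε in N , λ m N≤m →
    let l-ε< , <l+ε = close m N≤m
    in <-respˡ-≈ (+-congʳ l≈l′) l-ε< , <-respʳ-≈ (+-congʳ l≈l′) <l+ε

-- The cosine series: d'Alembert's equation and estimates of the terms.

module Cosine (R : RealNumbers) where
  open OrderedField R
  open Analysis R
  open Series R
  open import Algebra.Properties.Semiring.Exp semiring using (^-congˡ)
  open import Relation.Binary.Reasoning.Setoid setoid

  ι-! : ∀ n → 0# < ι (n !)
  ι-! zero    = ι-pos 0
  ι-! (suc n) = <-respʳ-≈ (sym (•1-homo-* (suc n) (n !))) (*-pos _ _ (ι-pos n) (ι-! n))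

  -- The divided powers xⁿ/n!, the coefficients of exp(xT) as a power series in T.
  dpow : Carrier → Seq
  dpow x n = x ^ n * ι (n !) ⁻¹

  dpow-zero : ∀ x → dpow x 0 ≈ 1#
  dpow-zero x = trans (*-congʳ (sym (+-identityʳ 1#))) (inverse (ι 1) (pos⇒≉0 (ι-pos 0)))

  dpow-suc : ∀ x n → ι (suc n) * dpow x (suc n) ≈ x * dpow x n
  dpow-suc x n = begin
    ι (suc n) * (x * x ^ n * F ⁻¹)   ≈⟨ solve 4 (λ i x p f → i :* (x :* p :* f) := x :* (p :* (i :* f))) refl _ _ _ _ ⟩
    x * (x ^ n * (ι (suc n) * F ⁻¹)) ≈⟨ *-congˡ (*-congˡ (⁻¹-unique f*[ιF⁻¹]≈1)) ⟩
    x * (x ^ n * ι (n !) ⁻¹)         ∎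
    where
    F = ι (suc n !)
    f*[ιF⁻¹]≈1 : ι (n !) * (ι (suc n) * F ⁻¹) ≈ 1#
    f*[ιF⁻¹]≈1 = begin
      ι (n !) * (ι (suc n) * F ⁻¹) ≈⟨ solve 3 (λ f i g → f :* (i :* g) := i :* f :* g) refl _ _ _ ⟩
      ι (suc n) * ι (n !) * F ⁻¹   ≈⟨ *-congʳ (•1-homo-* (suc n) (n !)) ⟨
      F * F ⁻¹                     ≈⟨ inverse F (pos⇒≉0 (ι-! (suc n))) ⟩
      1#                           ∎

  dpow-pos : ∀ {x} → 0# < x → ∀ n → 0# < dpow x n
  dpow-pos 0<x n = *-pos _ _ (^-pos 0<x n) (⁻¹-pos (ι-! n))

  -- The coefficients of the formal derivative of a power series.
  deriv : Seq → Seq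
  deriv a n = ι (suc n) * a (suc n)

  -- Shifting lowers the index of each coefficient by one, so `shift (deriv a)` exceeds
  -- `deriv (shift a)` by one copy of the coefficients. This is the correction in the induction for
  -- the product rule.
  conv-deriv-shift : ∀ a b n →
    conv (deriv a) b (suc n) ≈ conv (shift a) b (suc n) + conv (deriv (shift a)) b n
  conv-deriv-shift a b n = begin
    ι 1 * a 1 * b (suc n) + conv (shift (deriv a)) b n
      ≈⟨ +-cong (*-congʳ (trans (*-congʳ (+-identityʳ 1#)) (*-identityˡ _)))
           (trans (conv-cong {b = b} (λ k → trans (distribʳ _ _ _) (+-congʳ (*-identityˡ _)))
                             (λ _ → refl) n)
                  (conv-+ˡ (shift (shift a)) (deriv (shift a)) b n)) ⟩
    a 1 * b (suc n) + (conv (shift (shift a)) b n + conv (deriv (shift a)) b n)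
      ≈⟨ +-assoc _ _ _ ⟨
    conv (shift a) b (suc n) + conv (deriv (shift a)) b n  ∎

  leibniz : ∀ a b n → deriv (conv a b) n ≈ conv (deriv a) b n + conv a (deriv b) n
  leibniz a b zero = solve 5 (λ i a0 b1 a1 b0 → i :* (a0 :* b1 :+ a1 :* b0) :=
    i :* a1 :* b0 :+ a0 :* (i :* b1)) refl (ι 1) (a 0) (b 1) (a 1) (b 0)
  leibniz a b (suc n) = begin
    (1# + i) * (x + c)            ≈⟨ solve 3 (λ i x c → (:1 :+ i) :* (x :+ c) := (:1 :+ i) :* x :+ c :+ i :* c) refl i x c ⟩
    (1# + i) * x + c + i * c      ≈⟨ +-congˡ (leibniz (shift a) b n) ⟩
    (1# + i) * x + c + (d + e)    ≈⟨ solve 6 (λ i a b c d e →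
                                      i :* (a :* b) :+ c :+ (d :+ e) := c :+ d :+ (a :* (i :* b) :+ e)) refl (1# + i) _ _ c d e ⟩
    c + d + (a 0 * ((1# + i) * b (suc (suc n))) + e)  ≈⟨ +-congʳ (conv-deriv-shift a b n) ⟨
    conv (deriv a) b (suc n) + conv a (deriv b) (suc n) ∎
    where
    i = ι (suc n)
    x = a 0 * b (suc (suc n))
    c = conv (shift a) b (suc n)
    d = conv (deriv (shift a)) b n
    e = conv (shift a) (deriv b) n

  -- The binomial theorem as exp(xT) exp(yT) = exp((x + y)T). By the product rule both sides solve
  -- F′ = (x + y)F with the same constant term, and this determines the coefficients without
  -- binomial coefficients.
  conv-dpow : ∀ x y n → conv (dpow x) (dpow y) n ≈ dpow (x + y) n
  conv-dpow x y zero    = trans (*-cong (dpow-zero x) (dpow-zero y))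
    (trans (*-identityˡ 1#) (sym (dpow-zero (x + y))))
  conv-dpow x y (suc n) = *-cancelˡ (pos⇒≉0 (ι-pos n)) (begin
    deriv (conv (dpow x) (dpow y)) n
      ≈⟨ leibniz (dpow x) (dpow y) n ⟩
    conv (deriv (dpow x)) (dpow y) n + conv (dpow x) (deriv (dpow y)) n
      ≈⟨ +-cong (trans (conv-cong {b = dpow y} (dpow-suc x) (λ _ → refl) n)
                       (conv-scaleˡ x (dpow x) (dpow y) n))
                (trans (conv-cong {a = dpow x} (λ _ → refl) (dpow-suc y) n)
                       (conv-scaleʳ y (dpow x) (dpow y) n)) ⟩
    x * conv (dpow x) (dpow y) n + y * conv (dpow x) (dpow y) n
      ≈⟨ distribʳ _ _ _ ⟨
    (x + y) * conv (dpow x) (dpow y) n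
      ≈⟨ *-congˡ (conv-dpow x y n) ⟩
    (x + y) * dpow (x + y) n
      ≈⟨ dpow-suc (x + y) n ⟨
    ι (suc n) * dpow (x + y) (suc n) ∎)

  -- Unlike `2 ℕ.* n`, this unfolds to two successors, in step with the recursion of `conv`.
  double : ℕ → ℕ
  double zero    = zero
  double (suc n) = suc (suc (double n))

  double≡2* : ∀ n → double n ≡ 2 ℕ.* n
  double≡2* zero    = ≡.refl
  double≡2* (suc n) = ≡.cong suc (≡.trans (≡.cong suc (double≡2* n)) (≡.sym (ℕₚ.+-suc n (n ℕ.+ 0))))

  -- In a product of even total index, odd entries of a meet only odd entries of b, so vanishing is
  -- required of b alone.
  conv-even : ∀ a b → (∀ k → b (suc (double k)) ≈ 0#) →
              ∀ n → conv a b (double n) ≈ conv (a ∘ double) (b ∘ double) n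
  conv-even a b b-odd zero    = refl
  conv-even a b b-odd (suc n) = +-congˡ (begin
    a 1 * b (suc (double n)) + conv (a ∘ suc ∘ suc) b (double n)  ≈⟨ +-congʳ (trans (*-congˡ (b-odd n)) (zeroʳ _)) ⟩
    0# + conv (a ∘ suc ∘ suc) b (double n)                        ≈⟨ +-identityˡ _ ⟩
    conv (a ∘ suc ∘ suc) b (double n)                             ≈⟨ conv-even (a ∘ suc ∘ suc) b b-odd n ⟩
    conv (a ∘ suc ∘ suc ∘ double) (b ∘ double) n                  ∎)

  σ : Seq
  σ k = (- 1#) ^ k

  alternate : Seq → Seq
  alternate a k = σ k * a k

  conv-alternate : ∀ a b n → conv (alternate a) (alternate b) n ≈ alternate (conv a b) n
  conv-alternate a b zero    = solve 2 (λ x y → :1 :* x :* (:1 :* y) := :1 :* (x :* y)) refl _ _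
  conv-alternate a b (suc n) = begin
    1# * a 0 * (σ (suc n) * b (suc n)) + conv (shift (alternate a)) (alternate b) n
      ≈⟨ +-congˡ (trans (conv-cong {b = alternate b} (λ k → *-assoc (- 1#) (σ k) (a (suc k))) (λ _ → refl) n)
                 (trans (conv-scaleˡ (- 1#) (alternate (shift a)) (alternate b) n)
                        (*-congˡ (conv-alternate (shift a) b n)))) ⟩
    1# * a 0 * (- 1# * σ n * b (suc n)) + - 1# * (σ n * conv (shift a) b n)
      ≈⟨ solve 4 (λ s x y t → :1 :* x :* ((:- :1) :* s :* y) :+ (:- :1) :* (s :* t) :=
           (:- :1) :* s :* (x :* y :+ t)) refl _ _ _ _ ⟩
    - 1# * σ n * (a 0 * b (suc n) + conv (shift a) b n) ∎

  evenTerm : Carrier → Seq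
  evenTerm x k = dpow x (double k)

  cosTerm≈ : ∀ x k → cosTerm x k ≈ alternate (evenTerm x) k
  cosTerm≈ x k = trans (*-assoc _ _ _)
    (*-congˡ (reflexive (≡.cong (dpow x) (≡.sym (double≡2* k)))))

  cosTerm-cong : ∀ {x y} → x ≈ y → ∀ k → cosTerm x k ≈ cosTerm y k
  cosTerm-cong x≈y k = *-congʳ (*-congˡ (^-congˡ (2 ℕ.* k) x≈y))

  dpow-neg-even : ∀ y k → dpow (- y) (double k) ≈ dpow y (double k)
  dpow-neg-even y k = *-congʳ (even k)
    where
    even : ∀ k → (- y) ^ double k ≈ y ^ double k
    even zero    = refl
    even (suc k) = trans (*-congˡ (*-congˡ (even k)))
      (solve 2 (λ y p → (:- y) :* ((:- y) :* p) := y :* (y :* p)) refl y _)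

  dpow-neg-odd : ∀ y k → dpow (- y) (suc (double k)) ≈ - dpow y (suc (double k))
  dpow-neg-odd y k = *-cancelˡ (pos⇒≉0 (ι-pos (double k))) (begin
    i * dpow (- y) (suc (double k))   ≈⟨ dpow-suc (- y) (double k) ⟩
    - y * dpow (- y) (double k)       ≈⟨ *-congˡ (dpow-neg-even y k) ⟩
    - y * dpow y (double k)           ≈⟨ solve 2 (λ y p → (:- y) :* p := :- (y :* p)) refl y _ ⟩
    - (y * dpow y (double k))         ≈⟨ -‿cong (dpow-suc y (double k)) ⟨
    - (i * dpow y (suc (double k)))   ≈⟨ solve 2 (λ i p → :- (i :* p) := i :* (:- p)) refl i _ ⟩
    i * - dpow y (suc (double k))     ∎)
    where i = ι (suc (double k))

  -- Up to sign, the left side is the coefficient of index 2n in exp(xT)(exp(yT) + exp(-yT)). The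
  -- second factor is twice the even part of exp(yT), so only products of even terms survive, and
  -- the signs multiply.
  cosTerm-dAlembert : ∀ x y n → cosTerm (x + y) n + cosTerm (x - y) n ≈
                                conv (cosTerm x) (cosTerm y) n + conv (cosTerm x) (cosTerm y) n
  cosTerm-dAlembert x y n = begin
    cosTerm (x + y) n + cosTerm (x - y) n
      ≈⟨ trans (+-cong (cosTerm≈ (x + y) n) (cosTerm≈ (x - y) n)) (sym (distribˡ _ _ _)) ⟩
    σ n * (dpow (x + y) (double n) + dpow (x - y) (double n))
      ≈⟨ *-congˡ (trans (+-cong (sym (conv-dpow x y (double n))) (sym (conv-dpow x (- y) (double n))))
                        (sym (conv-+ʳ (dpow x) (dpow y) (dpow (- y)) (double n)))) ⟩
    σ n * conv (dpow x) (λ k → dpow y k + dpow (- y) k) (double n)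
      ≈⟨ *-congˡ (trans (conv-even (dpow x) (λ k → dpow y k + dpow (- y) k)
                           (λ k → trans (+-congˡ (dpow-neg-odd y k)) (-‿inverseʳ _)) n)
                        (trans (conv-cong {a = evenTerm x} (λ _ → refl) (λ k → +-congˡ (dpow-neg-even y k)) n)
                               (conv-+ʳ (evenTerm x) (evenTerm y) (evenTerm y) n))) ⟩
    σ n * (conv (evenTerm x) (evenTerm y) n + conv (evenTerm x) (evenTerm y) n)
      ≈⟨ trans (distribˡ _ _ _) (+-cong conv-cosTerm conv-cosTerm) ⟩
    conv (cosTerm x) (cosTerm y) n + conv (cosTerm x) (cosTerm y) n ∎
    where
    conv-cosTerm : σ n * conv (evenTerm x) (evenTerm y) n ≈ conv (cosTerm x) (cosTerm y) n
    conv-cosTerm = trans (sym (conv-alternate (evenTerm x) (evenTerm y) n))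
      (conv-cong (λ k → sym (cosTerm≈ x k)) (λ k → sym (cosTerm≈ y k)) n)

  evenTerm-nonneg : ∀ x → Nonneg (evenTerm x)
  evenTerm-nonneg x k = 0≤* (even k) (<⇒≤ (⁻¹-pos (ι-! (double k))))
    where
    even : ∀ k → 0# ≤ x ^ double k
    even zero    = <⇒≤ 0<1
    even (suc k) = ≤-respʳ-≈ (*-assoc _ _ _) (0≤* (0≤x*x x) (even k))

  -- The terms x^(2k)/(2k)! have successive ratios x²/`weight k`; the estimates below compare x²
  -- with this denominator.
  weight : Seq
  weight k = ι (suc (double k)) * ι (suc (suc (double k)))

  evenTerm-suc : ∀ x k → weight k * evenTerm x (suc k) ≈ x * x * evenTerm x k
  evenTerm-suc x k = begin
    i * j * dpow x (suc (suc (double k)))   ≈⟨ *-assoc _ _ _ ⟩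
    i * (j * dpow x (suc (suc (double k)))) ≈⟨ *-congˡ (dpow-suc x (suc (double k))) ⟩
    i * (x * dpow x (suc (double k)))       ≈⟨ solve 3 (λ i x p → i :* (x :* p) := x :* (i :* p)) refl _ _ _ ⟩
    x * (i * dpow x (suc (double k)))       ≈⟨ *-congˡ (dpow-suc x (double k)) ⟩
    x * (x * dpow x (double k))             ≈⟨ *-assoc _ _ _ ⟨
    x * x * dpow x (double k)               ∎
    where
    i = ι (suc (double k))
    j = ι (suc (suc (double k)))

  weight-pos : ∀ k → 0# < weight k
  weight-pos k = *-pos _ _ (ι-pos (double k)) (ι-pos (suc (double k)))

  weight-≥ : ∀ k → ι (suc (suc (double k))) ≤ weight k
  weight-≥ k = ≤-by (0≤* (ι-nonneg (double k)) (ι-nonneg (suc (suc (double k)))))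
    (solve 2 (λ i j → (:1 :+ i) :* j :- j := i :* j) refl _ _)

  ι-mono : ∀ {m n} → m ℕ.≤ n → ι m ≤ ι n
  ι-mono {n = n} z≤n = ι-nonneg n
  ι-mono (s≤s m≤n)   = +-mono-≤ ≤-refl (ι-mono m≤n)

  n≤double : ∀ n → n ℕ.≤ double n
  n≤double zero    = z≤n
  n≤double (suc n) = s≤s (ℕₚ.m≤n⇒m≤1+n (n≤double n))

  -- The ratio x²/`weight k` is at most 1/2, because 2x² < `ι N` ≤ `ι (2k + 2)` ≤ `weight k`.
  evenTerm-halves : ∀ x N → x * x + x * x < ι N → ∀ k → N ℕ.≤ k →
                    evenTerm x (suc k) + evenTerm x (suc k) ≤ evenTerm x k
  evenTerm-halves x N 2x²<N k N≤k = ≤-by (cancel-pos-≤ (weight-pos k)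
      (≤-respʳ-≈ (≈-by (+-cong (evenTerm-suc x k) (evenTerm-suc x k))
          (solve 4 (λ w x p q → (w :- (x :+ x)) :* p :- w :* (p :- (q :+ q)) :=
             w :* q :+ w :* q :- (x :* p :+ x :* p)) refl _ _ _ _))
        (0≤* (x≤y⇒0≤y-x 2x²≤w) (evenTerm-nonneg x k)))) refl
    where
    2x²≤w : x * x + x * x ≤ weight k
    2x²≤w = ≤-trans (<⇒≤ 2x²<N) (≤-trans (ι-mono (ℕₚ.≤-trans N≤k
      (ℕₚ.≤-trans (n≤double k) (ℕₚ.m≤n+m (double k) 2)))) (weight-≥ k))

  Σ-evenTerm-bounded : ExcludedMiddle 0ℓ → ∀ x → ∃[ b ] ∀ m → Σ (evenTerm x) m ≤ b
  Σ-evenTerm-bounded em x = bound N , λ m → [ below m , above m ]′ (ℕₚ.≤-total m N)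
    where
    N = proj₁ (archimedean em (x * x + x * x))
    halves = evenTerm-halves x N (proj₂ (archimedean em (x * x + x * x)))
    p = evenTerm x
    -- Nonincreasing in m from N on, since the terms at least halve.
    bound : Seq
    bound m = Σ p m + (p m + p m)
    Σ≤bound : ∀ m → Σ p m ≤ bound m
    Σ≤bound m = ≤-by (0≤+ (evenTerm-nonneg x m) (evenTerm-nonneg x m))
      (solve 2 (λ s t → s :+ t :- s := t) refl _ _)
    bound-anti : ∀ j → bound (j ℕ.+ N) ≤ bound N
    bound-anti zero    = ≤-refl
    bound-anti (suc j) = ≤-trans (≤-by (x≤y⇒0≤y-x (halves (j ℕ.+ N) (ℕₚ.m≤n+m N j)))
      (trans (+-congˡ (-‿cong (+-congʳ (Σ-last p (j ℕ.+ N)))))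
        (solve 3 (λ s t q → s :+ (t :+ t) :- (s :+ t :+ q) := t :- q) refl _ _ _)))
      (bound-anti j)
    below : ∀ m → m ℕ.≤ N → Σ p m ≤ bound N
    below m m≤N = ≤-trans (Σ-mono (evenTerm-nonneg x) m≤N) (Σ≤bound N)
    above : ∀ m → N ℕ.≤ m → Σ p m ≤ bound N
    above m N≤m = ≡.subst (λ k → Σ p k ≤ bound N) (ℕₚ.m∸n+n≡m N≤m)
      (≤-trans (Σ≤bound (m ℕ.∸ N ℕ.+ N)) (bound-anti (m ℕ.∸ N)))

  σ-cases : ∀ k → σ k ≈ 1# ⊎ σ k ≈ - 1#
  σ-cases zero    = inj₁ refl
  σ-cases (suc k) = [ (λ σ≈1 → inj₂ (trans (*-congˡ σ≈1) (*-identityʳ _)))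
                    , (λ σ≈-1 → inj₁ (trans (*-congˡ σ≈-1) (solve 0 ((:- :1) :* (:- :1) := :1) refl))) ]′
                    (σ-cases k)

  cosTerm-abs : ∀ x k → 0# ≤ cosTerm x k + evenTerm x k × cosTerm x k ≤ evenTerm x k
  cosTerm-abs x k with σ-cases k | 0≤+ (evenTerm-nonneg x k) (evenTerm-nonneg x k)
  ... | inj₁ σ≈1  | 0≤2p =
    ≤-respʳ-≈ (sym (+-congʳ t≈p)) 0≤2p , ≈⇒≤ t≈p
    where t≈p = trans (cosTerm≈ x k) (trans (*-congʳ σ≈1) (*-identityˡ _))
  ... | inj₂ σ≈-1 | 0≤2p =
    ≈⇒≤ (sym (trans (+-congʳ t≈-p) (-‿inverseˡ _))) ,
    ≤-by 0≤2p (trans (+-congˡ (-‿cong t≈-p)) (+-congˡ (-‿involutive _)))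
    where t≈-p = trans (cosTerm≈ x k) (trans (*-congʳ σ≈-1)
                   (solve 1 (λ p → (:- :1) :* p := :- p) refl _))

  -- The estimate behind Leibniz's criterion: a sum is its first term minus an alternating sum of
  -- the shifted sequence, which by induction lies between 0 and p 1 ≤ p 0.
  alternating-bounds : ∀ p → Nonneg p → (∀ k → p (suc k) ≤ p k) →
                       ∀ m → 0# ≤ Σ (alternate p) m × Σ (alternate p) m ≤ p 0
  alternating-step : ∀ p m → Σ (alternate p) (suc m) ≈ p 0 - Σ (alternate (shift p)) m

  alternating-step p m = begin
    1# * p 0 + Σ (λ k → - 1# * σ k * p (suc k)) m
      ≈⟨ +-congˡ (trans (Σ-cong (λ k → *-assoc (- 1#) (σ k) (p (suc k))) m) (Σ-scale (- 1#) (alternate (shift p)) m)) ⟩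
    1# * p 0 + - 1# * Σ (alternate (shift p)) m
      ≈⟨ solve 2 (λ x s → :1 :* x :+ (:- :1) :* s := x :- s) refl _ _ ⟩
    p 0 - Σ (alternate (shift p)) m ∎

  alternating-bounds p 0≤p anti zero    = ≤-refl , 0≤p 0
  alternating-bounds p 0≤p anti (suc m) =
    let 0≤s , s≤p₁ = alternating-bounds (shift p) (0≤p ∘ suc) (anti ∘ suc) m
        step = alternating-step p m
    in ≤-respʳ-≈ (sym step) (x≤y⇒0≤y-x (≤-trans s≤p₁ (anti 0))) ,
       ≤-respˡ-≈ (sym step) (≤-by 0≤s (solve 2 (λ x s → x :- (x :- s) := s) refl _ _))

  -- The ratio is below 1, since x² ≤ 1 < 2k + 2 ≤ `weight k`.
  evenTerm-anti : ∀ {x} → 0# < x → x ≤ 1# → ∀ k → evenTerm x (suc k) < evenTerm x k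
  evenTerm-anti {x} 0<x x≤1 k = <-by (cancel-pos-< (weight-pos k)
      (<-respʳ-≈ (≈-by (evenTerm-suc x k)
          (solve 4 (λ w x p q → (w :- x) :* p :- w :* (p :- q) := w :* q :- x :* p) refl _ _ _ _))
        (*-pos _ _ (x<y⇒0<y-x x²<w) (dpow-pos 0<x (double k))))) refl
    where
    x²<w : x * x < weight k
    x²<w = ≤-<-trans (*-mono-≤ (<⇒≤ 0<x) (<⇒≤ 0<1) x≤1 x≤1)
      (<-≤-trans (<-by (ι-pos (double k))
        (solve 1 (λ i → :1 :+ (:1 :+ i) :- :1 :* :1 := :1 :+ i) refl _)) (weight-≥ k))

-- Injectivity of the cosine on (0,π).

module CosineInjectivity (em : ExcludedMiddle 0ℓ) (R : RealNumbers) where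
  open OrderedField R
  open Analysis R
  open Series R
  open Cosine R
  open import Relation.Binary.Reasoning.Setoid setoid

  abstract
    -- Only summability matters afterwards; `abstract` keeps the suprema defining the value from
    -- unfolding.
    cos-exists : ∀ x → ∃ (AbsSum (cosTerm x))
    cos-exists x = let b , Σ≤b = Σ-evenTerm-bounded em x in
      dominated (cosTerm x) (evenTerm x) b (evenTerm-nonneg x)
        (λ k → proj₁ (cosTerm-abs x k)) (λ k → proj₂ (cosTerm-abs x k)) Σ≤b

  cos : Carrier → Carrier
  cos x = proj₁ (cos-exists x)

  cos-sum : ∀ x → AbsSum (cosTerm x) (cos x)
  cos-sum x = proj₂ (cos-exists x)

  Cos-cos : ∀ x → Cos x (cos x)
  Cos-cos x = absSum⇒Converges em (cos-sum x)

  Cos⇒≈cos : ∀ {x c} → Cos x c → c ≈ cos x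
  Cos⇒≈cos {x} x↦c = limit-unique x↦c (Cos-cos x)

  cos≈⇒Cos : ∀ {x c} → cos x ≈ c → Cos x c
  cos≈⇒Cos {x} cosx≈c = converges-resp-≈ cosx≈c (Cos-cos x)

  cos-cong : ∀ {x y} → x ≈ y → cos x ≈ cos y
  cos-cong {x} {y} x≈y = absSum-unique (cosTerm-cong x≈y) (cos-sum x) (cos-sum y)

  dAlembert : ∀ x y → cos (x + y) + cos (x - y) ≈ cos x * cos y + cos x * cos y
  dAlembert x y = absSum-unique (cosTerm-dAlembert x y)
    (absSum-+ (cos-sum (x + y)) (cos-sum (x - y)))
    (absSum-+ (absSum-conv (cos-sum x) (cos-sum y)) (absSum-conv (cos-sum x) (cos-sum y)))

  Σ-cosTerm : ∀ x m → Σ (cosTerm x) m ≈ Σ (alternate (evenTerm x)) m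
  Σ-cosTerm x = Σ-cong (cosTerm≈ x)

  cos-0 : cos 0# ≈ 1#
  cos-0 = ≤-antisym (limit-≤ 1 (Cos-cos 0#) λ m 1≤m → ≈⇒≤ (partial m 1≤m))
                    (limit-≥ 1 (Cos-cos 0#) λ m 1≤m → ≈⇒≤ (sym (partial m 1≤m)))
    where
    partial : ∀ m → 1 ℕ.≤ m → Σ (cosTerm 0#) m ≈ 1#
    partial (suc m) _ = begin
      Σ (cosTerm 0#) (suc m)                        ≈⟨ Σ-cosTerm 0# (suc m) ⟩
      Σ (alternate (evenTerm 0#)) (suc m)           ≈⟨ +-congˡ (trans (Σ-cong later m) (Σ-scale 0# (λ _ → 0#) m)) ⟩
      1# * evenTerm 0# 0 + 0# * Σ (λ _ → 0#) m      ≈⟨ +-cong (trans (*-identityˡ _) (dpow-zero 0#)) (zeroˡ _) ⟩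
      1# + 0#                                       ≈⟨ +-identityʳ 1# ⟩
      1#                                            ∎
      where
      -- Written as a product so that `Σ-scale` extracts the factor `0#`.
      later : ∀ k → alternate (evenTerm 0#) (suc k) ≈ 0# * 0#
      later k = solve 3 (λ s p f → s :* (:0 :* p :* f) := :0 :* :0) refl _ _ _

  cos-double : ∀ x → cos (x + x) ≈ cos x * cos x + cos x * cos x - 1#
  cos-double x = begin
    cos (x + x)                                ≈⟨ solve 2 (λ c d → c := c :+ d :- d) refl _ (cos (x - x)) ⟩
    cos (x + x) + cos (x - x) - cos (x - x)    ≈⟨ +-cong (dAlembert x x) (-‿cong (trans (cos-cong (-‿inverseʳ x)) cos-0)) ⟩
    cos x * cos x + cos x * cos x - 1#         ∎

  cos-small-nonneg : ∀ {x} → 0# < x → x ≤ 1# → 0# ≤ cos x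
  cos-small-nonneg {x} 0<x x≤1 = limit-≥ 0 (Cos-cos x) λ m _ →
    ≤-respʳ-≈ (sym (Σ-cosTerm x m)) (proj₁ (alternating-bounds (evenTerm x) (evenTerm-nonneg x)
      (λ k → <⇒≤ (evenTerm-anti 0<x x≤1 k)) m))

  -- From length 2 on, the partial sums are 1 - x²/2 plus an alternating sum starting with x⁴/24,
  -- hence at most 1 - (x²/2 - x⁴/24), a bound strictly below 1.
  cos-small-<1 : ∀ {x} → 0# < x → x ≤ 1# → cos x < 1#
  cos-small-<1 {x} 0<x x≤1 = ≤-<-trans (limit-≤ 2 (Cos-cos x) bounded)
    (<-by (x<y⇒0<y-x (evenTerm-anti 0<x x≤1 1))
      (solve 2 (λ p q → :1 :- (:1 :- (p :- q)) := p :- q) refl _ _))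
    where
    p = evenTerm x
    bounded : ∀ m → 2 ℕ.≤ m → Σ (cosTerm x) m ≤ 1# - (p 1 - p 2)
    bounded (suc (suc m)) _ = ≤-by
      (x≤y⇒0≤y-x (proj₂ (alternating-bounds (shift (shift p)) (evenTerm-nonneg x ∘ suc ∘ suc)
        (λ k → <⇒≤ (evenTerm-anti 0<x x≤1 (suc (suc k)))) m)))
      (trans (+-congˡ (-‿cong (trans (Σ-cosTerm x (suc (suc m)))
          (trans (alternating-step p (suc m))
            (+-cong (dpow-zero x) (-‿cong (alternating-step (shift p) m)))))))
        (solve 3 (λ p q s → :1 :- (p :- q) :- (:1 :- (p :- s)) := q :- s) refl _ _ _))
    bounded (suc zero) (s≤s ())
    bounded zero       ()

  x≤2^ : ∀ x → ∃[ k ] x ≤ 2# ^ k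
  x≤2^ x = let n , x<ιn = archimedean em x in n , ≤-trans (<⇒≤ x<ιn) (ι≤2^ n)
    where
    1≤2^ : ∀ n → 1# ≤ 2# ^ n
    1≤2^ zero    = ≤-refl
    1≤2^ (suc n) = ≤-respˡ-≈ (*-identityˡ 1#) (*-mono-≤ (<⇒≤ 0<1) (<⇒≤ 0<2)
      (≤-by (<⇒≤ 0<1) (solve 0 (:2 :- :1 := :1) refl)) (1≤2^ n))
    ι≤2^ : ∀ n → ι n ≤ 2# ^ n
    ι≤2^ zero    = <⇒≤ 0<1
    ι≤2^ (suc n) = ≤-respʳ-≈ (solve 1 (λ p → p :+ p := :2 :* p) refl _)
      (+-mono-≤ (1≤2^ n) (ι≤2^ n))

  ≤-of-doubles : ∀ {x y} → x + x ≤ y + y → x ≤ y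
  ≤-of-doubles {x} {y} x+x≤y+y = ≤-by (double-nonneg (≤-respʳ-≈
    (solve 2 (λ x y → y :+ y :- (x :+ x) := y :- x :+ (y :- x)) refl x y)
    (x≤y⇒0≤y-x x+x≤y+y))) refl

  module _ {h} (cos≉0 : ∀ t → 0# < t → t < h → ¬ Cos t 0#) where

    -- By halving, down to the interval (0,1] where the series shows it.
    cos²≉1 : ∀ k u → u ≤ 2# ^ k → 0# < u → u < h + h → ¬ cos u * cos u ≈ 1#
    cos²≉1 zero u u≤1 0<u _ cos²≈1 with square≈1 cos²≈1
    ... | inj₁ cos≈1  = <-irrefl cos≈1 (cos-small-<1 0<u u≤1)
    ... | inj₂ cos≈-1 = <⇒≱ (<-by 0<1 (trans (+-congˡ (-‿cong cos≈-1))
            (solve 0 (:0 :- (:- :1) := :1) refl))) (cos-small-nonneg 0<u u≤1)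
    cos²≉1 (suc k) u u≤2^ 0<u u<2h cos²≈1 with square≈1 cos²≈1
    -- From cos u = 2 cos² v - 1 with v = u/2: the value 1 returns cos² v = 1 at half the argument.
    ... | inj₁ cos≈1  = cos²≉1 k v v≤2^ 0<v (<-trans v<u u<2h)
            (double-injective (≈-by (trans (sym cos-u) cos≈1)
              (solve 1 (λ c → c :+ c :- :2 := c :+ c :- :1 :- :1) refl _)))
      where
      v = u * ½
      0<v = half-pos 0<u
      v<u : v < u
      v<u = <-by 0<v (trans (+-congʳ (sym (half-sum u))) (solve 1 (λ v → v :+ v :- v := v) refl v))
      v≤2^ : v ≤ 2# ^ k
      v≤2^ = ≤-of-doubles (≤-respˡ-≈ (sym (half-sum u))
        (≤-respʳ-≈ (solve 1 (λ p → :2 :* p := p :+ p) refl _) u≤2^))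
      cos-u : cos u ≈ cos v * cos v + cos v * cos v - 1#
      cos-u = trans (cos-cong (sym (half-sum u))) (cos-double v)
    -- The value -1 gives cos v = 0 at v < h, before the first zero.
    ... | inj₂ cos≈-1 = cos≉0 v (half-pos 0<u) v<h (cos≈⇒Cos cos-v≈0)
      where
      v = u * ½
      v<h : v < h
      v<h = [ (λ v<h → v<h) , (λ h≤v → ⊥-elim (<⇒≱ u<2h
        (≤-respʳ-≈ (half-sum u) (+-mono-≤ h≤v h≤v)))) ]′ (<⊎≥ v h)
      cos-v≈0 : cos v ≈ 0#
      cos-v≈0 = [ (λ c≈0 → c≈0) , (λ c≈0 → c≈0) ]′ (zero-product (double-injective
        (≈-by (trans (sym (trans (cos-cong (sym (half-sum u))) (cos-double v))) cos≈-1)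
          (solve 1 (λ c → c :+ c :- (:0 :+ :0) := c :+ c :- :1 :- :- :1) refl _))))

    cos²≉1-on-0-2h : ∀ {u} → 0# < u → u < h + h → ¬ cos u * cos u ≈ 1#
    cos²≉1-on-0-2h {u} = let k , u≤2^ = x≤2^ u in cos²≉1 k u u≤2^

    -- With m = (a + b)/2 and v = (b - a)/2, d'Alembert's equation turns
    -- cos a = cos b into (1 - cos² m)(1 - cos² v) = 0.
    cos-separates : ∀ {a b} → 0# < a → a < b → b < h + h → ¬ cos a ≈ cos b
    cos-separates {a} {b} 0<a a<b b<2h cosa≈cosb =
      [ (λ e → cos²≉1-on-0-2h 0<m m<2h (x-y≈0⇒x≈y e))
      , (λ e → cos²≉1-on-0-2h 0<v v<2h (x-y≈0⇒x≈y e)) ]′ (zero-product product≈0)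
      where
      m = (a + b) * ½
      v = (b - a) * ½
      m+v≈b : m + v ≈ b
      m+v≈b = trans (solve 3 (λ a b h → (a :+ b) :* h :+ (b :- a) :* h := b :* h :+ b :* h)
        refl a b ½) (half-sum b)
      m-v≈a : m - v ≈ a
      m-v≈a = trans (solve 3 (λ a b h → (a :+ b) :* h :- (b :- a) :* h := a :* h :+ a :* h)
        refl a b ½) (half-sum a)
      0<v : 0# < v
      0<v = half-pos (x<y⇒0<y-x a<b)
      0<m : 0# < m
      0<m = half-pos (0<+ 0<a (<-trans 0<a a<b))
      m<2h : m < h + h
      m<2h = <-trans (<-by 0<v (trans (+-congʳ (sym m+v≈b))
        (solve 2 (λ m v → m :+ v :- m := v) refl m v))) b<2h
      v<2h : v < h + h
      v<2h = <-trans (<-by 0<m (trans (+-congʳ (sym m+v≈b))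
        (solve 2 (λ m v → m :+ v :- v := m) refl m v))) b<2h
      c = cos a
      p = cos m
      q = cos v
      c≈pq : c ≈ p * q
      c≈pq = double-injective (trans (+-cong (trans cosa≈cosb (cos-cong (sym m+v≈b)))
        (cos-cong (sym m-v≈a))) (dAlembert m v))
      -- Since 2m = b + a and 2v = b - a, d'Alembert's equation at (b, a) gives cos 2m + cos 2v =
      -- 2c². With c = pq and the doubling formula this reads 2p² - 1 + 2q² - 1 = 2p²q², which
      -- factors.
      cos-sums : p * p + p * p - 1# + (q * q + q * q - 1#) ≈ c * c + c * c
      cos-sums = begin
        p * p + p * p - 1# + (q * q + q * q - 1#)   ≈⟨ +-cong (cos-double m) (cos-double v) ⟨
        cos (m + m) + cos (v + v)                   ≈⟨ +-cong (cos-cong (trans (half-sum (a + b)) (+-comm a b))) (cos-cong (half-sum (b - a))) ⟩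
        cos (b + a) + cos (b - a)                   ≈⟨ dAlembert b a ⟩
        cos b * c + cos b * c                       ≈⟨ +-cong (*-congʳ cosa≈cosb) (*-congʳ cosa≈cosb) ⟨
        c * c + c * c                               ∎
      product≈0 : (p * p - 1#) * (q * q - 1#) ≈ 0#
      product≈0 = double-injective (≈-by
        (trans (+-cong c*c≈ c*c≈) (sym cos-sums))
        (solve 2 (λ P Q → (P :- :1) :* (Q :- :1) :+ (P :- :1) :* (Q :- :1) :- (:0 :+ :0) :=
          P :* Q :+ P :* Q :- (P :+ P :- :1 :+ (Q :+ Q :- :1))) refl (p * p) (q * q)))
        where
        c*c≈ : p * p * (q * q) ≈ c * c
        c*c≈ = trans (solve 2 (λ p q → p :* p :* (q :* q) := p :* q :* (p :* q)) refl p q)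
          (sym (*-cong c≈pq c≈pq))

  half-π-≤ : ∀ {h h′} → 0# < h → Cos h 0# → (∀ t → 0# < t → t < h′ → ¬ Cos t 0#) → h′ ≤ h
  half-π-≤ 0<h cosh≈0 cos≉0 = ≮⇒≥ λ h<h′ → cos≉0 _ 0<h h<h′ cosh≈0

  -- Every strict angle carries its own witness of π; identifying them places two angles in one
  -- interval.
  π-unique : ∀ {π π′} → IsPi π → IsPi π′ → π ≈ π′
  π-unique (h , π≈ , 0<h , cosh , least) (h′ , π′≈ , 0<h′ , cosh′ , least′) =
    trans π≈ (trans (+-cong h≈h′ h≈h′) (sym π′≈))
    where h≈h′ = ≤-antisym (half-π-≤ 0<h′ cosh′ least) (half-π-≤ 0<h cosh least′)

  StrictAngle : Carrier → Set
  StrictAngle θ = ∃[ π ] IsPi π × 0# < θ × θ < π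

  -- This discards the angles of three points of the axis, which are 0 or π.
  Cos²≉1 : ∀ {θ c} → StrictAngle θ → Cos θ c → ¬ c * c ≈ 1#
  Cos²≉1 (π , (h , π≈ , _ , _ , least) , 0<θ , θ<π) θ↦c c²≈1 =
    cos²≉1-on-0-2h least 0<θ (<-respʳ-≈ π≈ θ<π)
      (trans (sym (*-cong (Cos⇒≈cos θ↦c) (Cos⇒≈cos θ↦c))) c²≈1)

  Cos-injective : ∀ {θ θ′ c c′} → StrictAngle θ → StrictAngle θ′ →
                  Cos θ c → Cos θ′ c′ → c ≈ c′ → θ ≈ θ′
  Cos-injective {θ} {θ′} (π , isPi@(h , π≈ , _ , _ , least) , 0<θ , θ<π) (π′ , isPi′ , 0<θ′ , θ′<π′)
    θ↦c θ′↦c′ c≈c′ with compare θ θ′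
  ... | tri< θ<θ′ _ _ = ⊥-elim (cos-separates least 0<θ θ<θ′
          (<-respʳ-≈ (trans (π-unique isPi′ isPi) π≈) θ′<π′) cosθ≈cosθ′)
    where cosθ≈cosθ′ = trans (sym (Cos⇒≈cos θ↦c)) (trans c≈c′ (Cos⇒≈cos θ′↦c′))
  ... | tri≈ _ θ≈θ′ _ = θ≈θ′
  ... | tri> _ _ θ′<θ = ⊥-elim (cos-separates least 0<θ′ θ′<θ (<-respʳ-≈ π≈ θ<π) cosθ′≈cosθ)
    where cosθ′≈cosθ = trans (sym (Cos⇒≈cos θ′↦c′)) (trans (sym c≈c′) (Cos⇒≈cos θ↦c))

-- The least zero of a Lipschitz function on [0,1].

module FirstZero (R : RealNumbers) where
  open OrderedField R

  infix 4 _∈±_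
  -- This is |x| ≤ r, as two nonnegative expressions, so that bounds combine by ring identities
  -- instead of case distinctions on signs.
  _∈±_ : Carrier → Carrier → Set
  x ∈± r = 0# ≤ r + x × 0# ≤ r - x

  ∈±-resp-≈ : ∀ {x y r s} → x ≈ y → r ≈ s → x ∈± r → y ∈± s
  ∈±-resp-≈ x≈y r≈s (lo , hi) =
    ≤-respʳ-≈ (+-cong r≈s x≈y) lo , ≤-respʳ-≈ (+-cong r≈s (-‿cong x≈y)) hi

  ∈±-+ : ∀ {x y r s} → x ∈± r → y ∈± s → x + y ∈± r + s
  ∈±-+ {x} {y} {r} {s} (lo , hi) (lo′ , hi′) =
    ≤-respʳ-≈ (solve 4 (λ x y r s → r :+ x :+ (s :+ y) := r :+ s :+ (x :+ y)) refl x y r s)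
      (0≤+ lo lo′) ,
    ≤-respʳ-≈ (solve 4 (λ x y r s → r :- x :+ (s :- y) := r :+ s :- (x :+ y)) refl x y r s)
      (0≤+ hi hi′)

  ∈±-neg : ∀ {x r} → x ∈± r → - x ∈± r
  ∈±-neg (lo , hi) = hi , ≤-respʳ-≈ (+-congˡ (sym (-‿involutive _))) lo

  ∈±-* : ∀ {x y r s} → x ∈± r → y ∈± s → x * y ∈± r * s
  ∈±-* {x} {y} {r} {s} (lo , hi) (lo′ , hi′) =
    double-nonneg (≤-respʳ-≈ (solve 4 (λ x y r s →
        (r :+ x) :* (s :+ y) :+ (r :- x) :* (s :- y) := r :* s :+ x :* y :+ (r :* s :+ x :* y))
        refl x y r s) (0≤+ (0≤* lo lo′) (0≤* hi hi′))) ,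
    double-nonneg (≤-respʳ-≈ (solve 4 (λ x y r s →
        (r :- x) :* (s :+ y) :+ (r :+ x) :* (s :- y) := r :* s :- x :* y :+ (r :* s :- x :* y))
        refl x y r s) (0≤+ (0≤* hi lo′) (0≤* lo hi′)))

  -- Everything refers to [0,1]. The bound `K` is carried along because the Lipschitz constant of a
  -- product depends on the bounds of its factors.
  record Lipschitz (F : Carrier → Carrier) : Set where
    field
      cong      : ∀ {x y} → x ≈ y → F x ≈ F y
      {K M}     : Carrier
      bounded   : ∀ {x} → 0# ≤ x → x ≤ 1# → F x ∈± K
      lipschitz : ∀ {x y} → 0# ≤ x → x ≤ y → y ≤ 1# → F y - F x ∈± M * (y - x)
      0≤M       : 0# ≤ M

  open Lipschitz

  0∈±0 : 0# ∈± 0#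
  0∈±0 = ≈⇒≤ (sym (+-identityˡ 0#)) , ≈⇒≤ (sym (-‿inverseʳ 0#))

  nonneg-∈± : ∀ {x r} → 0# ≤ x → x ≤ r → x ∈± r
  nonneg-∈± 0≤x x≤r = 0≤+ (≤-trans 0≤x x≤r) 0≤x , x≤y⇒0≤y-x x≤r

  lipschitz-const : ∀ {c} → 0# ≤ c → Lipschitz (λ _ → c)
  lipschitz-const {c} 0≤c = record
    { cong = λ _ → refl
    ; bounded = λ _ _ → nonneg-∈± 0≤c ≤-refl
    ; lipschitz = λ _ _ _ → ∈±-resp-≈ (sym (-‿inverseʳ c)) (sym (zeroˡ _)) 0∈±0
    ; 0≤M = ≤-refl
    }

  lipschitz-id : Lipschitz (λ t → t)
  lipschitz-id = record
    { cong = λ x≈y → x≈y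
    ; bounded = nonneg-∈±
    ; lipschitz = λ _ x≤y _ → ∈±-resp-≈ refl (sym (*-identityˡ _)) (nonneg-∈± (x≤y⇒0≤y-x x≤y) ≤-refl)
    ; 0≤M = <⇒≤ 0<1
    }

  lipschitz-+ : ∀ {F G} → Lipschitz F → Lipschitz G → Lipschitz (λ t → F t + G t)
  lipschitz-+ f g = record
    { cong = λ x≈y → +-cong (cong f x≈y) (cong g x≈y)
    ; bounded = λ 0≤x x≤1 → ∈±-+ (bounded f 0≤x x≤1) (bounded g 0≤x x≤1)
    ; lipschitz = λ 0≤x x≤y y≤1 → ∈±-resp-≈
        (solve 4 (λ a b c d → a :- b :+ (c :- d) := a :+ c :- (b :+ d)) refl _ _ _ _)
        (sym (distribʳ _ _ _)) (∈±-+ (lipschitz f 0≤x x≤y y≤1) (lipschitz g 0≤x x≤y y≤1))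
    ; 0≤M = 0≤+ (0≤M f) (0≤M g)
    }

  lipschitz-neg : ∀ {F} → Lipschitz F → Lipschitz (λ t → - F t)
  lipschitz-neg f = record
    { cong = λ x≈y → -‿cong (cong f x≈y)
    ; bounded = λ 0≤x x≤1 → ∈±-neg (bounded f 0≤x x≤1)
    ; lipschitz = λ 0≤x x≤y y≤1 → ∈±-resp-≈
        (solve 2 (λ a b → :- (a :- b) := :- a :- :- b) refl _ _) refl
        (∈±-neg (lipschitz f 0≤x x≤y y≤1))
    ; 0≤M = 0≤M f
    }

  bound-nonneg : ∀ {F} (f : Lipschitz F) → 0# ≤ K f
  bound-nonneg f = let lo , hi = bounded f ≤-refl (<⇒≤ 0<1) in double-nonneg (≤-respʳ-≈
    (solve 2 (λ k x → k :+ x :+ (k :- x) := k :+ k) refl _ _) (0≤+ lo hi))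

  lipschitz-* : ∀ {F G} → Lipschitz F → Lipschitz G → Lipschitz (λ t → F t * G t)
  lipschitz-* f g = record
    { cong = λ x≈y → *-cong (cong f x≈y) (cong g x≈y)
    ; bounded = λ 0≤x x≤1 → ∈±-* (bounded f 0≤x x≤1) (bounded g 0≤x x≤1)
    ; lipschitz = λ 0≤x x≤y y≤1 → ∈±-resp-≈
        (solve 4 (λ a b c d → (a :- b) :* c :+ b :* (c :- d) := a :* c :- b :* d) refl _ _ _ _)
        (solve 5 (λ m d k k′ m′ → m :* d :* k :+ k′ :* (m′ :* d) := (m :* k :+ k′ :* m′) :* d)
          refl (M f) _ (K g) (K f) (M g))
        (∈±-+ (∈±-* (lipschitz f 0≤x x≤y y≤1) (bounded g (≤-trans 0≤x x≤y) y≤1))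
              (∈±-* (bounded f 0≤x (≤-trans x≤y y≤1)) (lipschitz g 0≤x x≤y y≤1)))
    ; 0≤M = 0≤+ (0≤* (0≤M f) (bound-nonneg g)) (0≤* (bound-nonneg f) (0≤M g))
    }

  modulus : ∀ {M ε} → 0# ≤ M → 0# < ε → ∃[ δ ] 0# < δ × M * δ < ε
  modulus {M} {ε} 0≤M 0<ε = δ , 0<δ , <-by 0<δ (trans (+-congʳ (sym [M+1]δ≈ε))
      (solve 2 (λ m d → (m :+ :1) :* d :- m :* d := d) refl M δ))
    where
    0<M+1 : 0# < M + 1#
    0<M+1 = <-respʳ-≈ (+-comm 1# M) (0<+≤ 0<1 0≤M)
    -- Dividing by M + 1 covers M = 0 as well.
    δ = ε * (M + 1#) ⁻¹
    0<δ = *-pos _ _ 0<ε (⁻¹-pos 0<M+1)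
    [M+1]δ≈ε : (M + 1#) * δ ≈ ε
    [M+1]δ≈ε = trans (solve 3 (λ m e i → m :* (e :* i) := e :* (m :* i)) refl _ ε _)
      (trans (*-congˡ (inverse _ (pos⇒≉0 0<M+1))) (*-identityʳ ε))

  -- The zero is the supremum s of those t with F > 0 on all of [0,t], so F > 0 before s. A negative
  -- value at s would extend to the left of s, and a positive one to the right, either past the
  -- supremum or up to b.
  first-zero : ∀ {F b} → Lipschitz F → 0# < F 0# → 0# ≤ b → b ≤ 1# → F b ≤ 0# →
               ∃[ s ] 0# ≤ s × s ≤ b × F s ≈ 0# × (∀ t → 0# ≤ t → t < s → 0# < F t)
  first-zero {F} {b} f 0<F0 0≤b b≤1 Fb≤0 = s , 0≤s , s≤b , ≤-antisym Fs≤0 0≤Fs , positive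
    where
    PositiveUpTo : Carrier → Set
    PositiveUpTo t = ∀ y → 0# ≤ y → y ≤ t → 0# < F y
    0-in : PositiveUpTo 0#
    0-in y 0≤y y≤0 = <-respʳ-≈ (cong f (≤-antisym 0≤y y≤0)) 0<F0
    b-above : ∀ t → PositiveUpTo t → t ≤ b
    b-above t pos = ≮⇒≥ λ b<t → <⇒≱ (pos b 0≤b (<⇒≤ b<t)) Fb≤0
    sup = complete PositiveUpTo (0# , 0-in) (b , b-above)
    s = proj₁ sup
    above = proj₁ (proj₂ sup)
    least = proj₂ (proj₂ sup)
    0≤s : 0# ≤ s
    0≤s = above 0# 0-in
    s≤b : s ≤ b
    s≤b = least b b-above
    positive : ∀ t → 0# ≤ t → t < s → 0# < F t
    positive t 0≤t t<s = [ (λ 0<Ft → 0<Ft) , (λ Ft≤0 → ⊥-elim (<⇒≱ t<s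
      (least t λ y pos → ≮⇒≥ λ t<y → <⇒≱ (pos t 0≤t (<⇒≤ t<y)) Ft≤0))) ]′ (<⊎≥ 0# (F t))

    0≤Fs : 0# ≤ F s
    0≤Fs = ≮⇒≥ λ Fs<0 →
      let δ , 0<δ , Mδ<-Fs = modulus (0≤M f) (neg-flip Fs<0)
          0<s = ≤∧≉⇒< 0≤s λ 0≈s → <⇒≱ 0<F0 (<⇒≤ (<-respˡ-≈ (cong f (sym 0≈s)) Fs<0))
          contradiction : ∀ t → 0# ≤ t → t < s → s - t ≤ δ → ⊥
          contradiction t 0≤t t<s s-t≤δ = <⇒≱ (<-by
            (0<+≤ (x<y⇒0<y-x (≤-<-trans (*-monoˡ-≤ (0≤M f) s-t≤δ) Mδ<-Fs))
                  (proj₁ (lipschitz f 0≤t (<⇒≤ t<s) (≤-trans s≤b b≤1))))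
            (solve 3 (λ u v m → :0 :- v := :- u :- m :+ (m :+ (u :- v))) refl (F s) (F t) _))
            (<⇒≤ (positive t 0≤t t<s))
      -- The offending point is s - δ, or 0 if that is negative or zero; both are within δ of s.
      in [ (λ δ<s → contradiction (s - δ) (x≤y⇒0≤y-x (<⇒≤ δ<s))
              (<-by 0<δ (solve 2 (λ s d → s :- (s :- d) := d) refl s δ))
              (≈⇒≤ (solve 2 (λ s d → s :- (s :- d) := d) refl s δ)))
         , (λ s≤δ → contradiction 0# ≤-refl 0<s
              (≤-respˡ-≈ (solve 1 (λ s → s := s :- :0) refl s) s≤δ)) ]′ (<⊎≥ δ s)

    Fs≤0 : F s ≤ 0#
    Fs≤0 = ≮⇒≥ λ 0<Fs →
      let δ , 0<δ , Mδ<Fs = modulus (0≤M f) 0<Fs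
          near : ∀ t → s ≤ t → t ≤ s + δ → t ≤ 1# → 0# < F t
          near t s≤t t≤s+δ t≤1 = <-by
            (0<+≤ (x<y⇒0<y-x (≤-<-trans (*-monoˡ-≤ (0≤M f) (≤-by (x≤y⇒0≤y-x t≤s+δ)
                     (solve 3 (λ s t d → d :- (t :- s) := s :+ d :- t) refl s t δ))) Mδ<Fs))
                  (proj₁ (lipschitz f 0≤s s≤t t≤1)))
            (solve 3 (λ u v m → v :- :0 := u :- m :+ (m :+ (v :- u))) refl (F s) (F t) _)
          s+δ>s = <-by 0<δ (solve 2 (λ s d → s :+ d :- s := d) refl s δ)
      -- If s + δ < b, positivity reaches beyond the supremum; otherwise b itself is within δ of s.
      in [ (λ s+δ<b → <⇒≱ s+δ>s (above (s + δ) λ y 0≤y y≤s+δ →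
              [ positive y 0≤y
              , (λ s≤y → near y s≤y y≤s+δ (≤-trans y≤s+δ (≤-trans (<⇒≤ s+δ<b) b≤1))) ]′ (<⊎≥ y s)))
         , (λ b≤s+δ → <⇒≱ (near b s≤b b≤s+δ b≤1) Fb≤0) ]′ (<⊎≥ (s + δ) b)

-- A unit complex number with argument π/n.

module RootOfUnity (R : RealNumbers) where
  open OrderedField R
  open FirstZero R
  open Lipschitz using () renaming (cong to lipschitz-cong)
  open import Relation.Binary.Reasoning.Setoid setoid

  -- The modulus of (1 + t i)² = (1 - t²) + 2 t i.
  norm : Carrier → Carrier
  norm t = 1# + t * t

  norm-pos : ∀ t → 0# < norm t
  norm-pos t = 0<+≤ 0<1 (0≤x*x t)

  -- chord k t is the imaginary part of ((1 - t²) + 2 t i)ᵏ divided by 2 t.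
  chord : ℕ → Carrier → Carrier
  chord zero          t = 0#
  chord (suc zero)    t = 1#
  -- From w² = 2 Re(w) w - |w|² for w = (1 - t²) + 2 t i, whose modulus is `norm t`.
  chord (suc (suc k)) t = 2# * (1# - t * t) * chord (suc k) t - norm t * norm t * chord k t

  chord-lipschitz : ∀ k → Lipschitz (chord k)
  chord-lipschitz zero          = lipschitz-const ≤-refl
  chord-lipschitz (suc zero)    = lipschitz-const (<⇒≤ 0<1)
  chord-lipschitz (suc (suc k)) = lipschitz-+
    (lipschitz-* (lipschitz-* (lipschitz-const (<⇒≤ 0<2)) (lipschitz-+ one (lipschitz-neg square)))
                 (chord-lipschitz (suc k)))
    (lipschitz-neg (lipschitz-* (lipschitz-* (lipschitz-+ one square) (lipschitz-+ one square))
                                (chord-lipschitz k)))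
    where
    one    = lipschitz-const (<⇒≤ 0<1)
    square = lipschitz-* lipschitz-id lipschitz-id

  -- The positive value at 0 starts the search for a zero, and later shows that the zero found is
  -- not 0.
  chord-0 : ∀ k → chord k 0# ≈ ι k
  chord-0 zero          = refl
  chord-0 (suc zero)    = sym (+-identityʳ 1#)
  chord-0 (suc (suc k)) = trans (+-cong (*-congˡ (chord-0 (suc k))) (-‿cong (*-congˡ (chord-0 k))))
    (solve 1 (λ i → :2 :* (:1 :- :0 :* :0) :* (:1 :+ i) :- (:1 :+ :0 :* :0) :* (:1 :+ :0 :* :0) :* i :=
      :1 :+ (:1 :+ i)) refl (ι k))

  -- The number s is tan(π/(2n)). The bounds in `earlier` include t = s, where the powers will be
  -- formed.
  record LeastZero (n : ℕ) : Set where
    field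
      s        : Carrier
      0≤s      : 0# ≤ s
      s≤1      : s ≤ 1#
      vanishes : chord n s ≈ 0#
      before   : ∀ t → 0# ≤ t → t < s → 0# < chord n t
      earlier  : ∀ k → 1 ℕ.≤ k → k ℕ.< n → ∀ t → 0# ≤ t → t ≤ s → 0# < chord k t

  -- At the first zero of chord (n+1), chord (n+2) has the sign of - chord n, so
  -- that its first zero comes earlier.
  leastZero : ∀ n → LeastZero (2 ℕ.+ n)
  leastZero zero = record
    -- `chord 2 t` is 2(1 - t²), with first zero 1 = tan(π/4).
    { s = 1#
    ; 0≤s = <⇒≤ 0<1
    ; s≤1 = ≤-refl
    ; vanishes = solve 0 (:2 :* (:1 :- :1 :* :1) :* :1 :- (:1 :+ :1 :* :1) :* (:1 :+ :1 :* :1) :* :0 := :0) refl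
    ; before = λ t 0≤t t<1 → <-respʳ-≈
        (solve 1 (λ t → :2 :* ((:1 :- t) :* (:1 :+ t)) := :2 :* (:1 :- t :* t) :* :1 :- (:1 :+ t :* t) :* (:1 :+ t :* t) :* :0) refl t)
        (*-pos _ _ 0<2 (*-pos _ _ (x<y⇒0<y-x t<1) (0<+≤ 0<1 0≤t)))
    ; earlier = earlier
    }
    where
    earlier : ∀ k → 1 ℕ.≤ k → k ℕ.< 2 → ∀ t → 0# ≤ t → t ≤ 1# → 0# < chord k t
    earlier (suc zero)    _ _ _ _ _ = 0<1
    earlier (suc (suc k)) _ (s≤s (s≤s ()))
  leastZero (suc n) = record
    { s = s′
    ; 0≤s = 0≤s′
    ; s≤1 = ≤-trans s′≤s s≤1
    ; vanishes = vanishes′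
    ; before = before′
    ; earlier = λ k 1≤k k<n+3 t 0≤t t≤s′ → [ (λ k<n+2 → earlier k 1≤k k<n+2 t 0≤t (≤-trans t≤s′ s′≤s))
        , (λ { ≡.refl → before t 0≤t (≤-<-trans t≤s′ s′<s) }) ]′ (ℕₚ.m<1+n⇒m<n∨m≡n k<n+3)
    }
    where
    open LeastZero (leastZero n)
    next<0 : chord (3 ℕ.+ n) s < 0#
    next<0 = <-by (*-pos _ _ (*-pos _ _ (norm-pos s) (norm-pos s))
                             (earlier (suc n) (s≤s z≤n) ℕₚ.≤-refl s 0≤s ≤-refl))
      (trans (+-congˡ (-‿cong (+-congʳ (*-congˡ vanishes))))
        (solve 2 (λ a x → :0 :- (a :* :0 :- x) := x) refl _ _))
    found = first-zero (chord-lipschitz (3 ℕ.+ n))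
      (<-respʳ-≈ (sym (chord-0 (3 ℕ.+ n))) (ι-pos (2 ℕ.+ n))) 0≤s s≤1 (<⇒≤ next<0)
    s′ = proj₁ found
    0≤s′ = proj₁ (proj₂ found)
    s′≤s = proj₁ (proj₂ (proj₂ found))
    vanishes′ = proj₁ (proj₂ (proj₂ (proj₂ found)))
    before′ = proj₂ (proj₂ (proj₂ (proj₂ found)))
    -- Strictness matters: `chord (2 ℕ.+ n)` vanishes at s, and must be positive on all of [0,s′].
    s′<s : s′ < s
    s′<s = ≤∧≉⇒< s′≤s λ s′≈s → <-irrefl
      (trans (lipschitz-cong (chord-lipschitz (3 ℕ.+ n)) (sym s′≈s)) vanishes′) next<0

  -- The powers re k + im k i of a complex number on the unit circle, with
  -- argument π/n.
  record HalfTurn (n : ℕ) : Set where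
    field
      re im  : ℕ → Carrier
      re-+   : ∀ j k → re (j ℕ.+ k) ≈ re j * re k - im j * im k
      im-+   : ∀ j k → im (j ℕ.+ k) ≈ im j * re k + re j * im k
      unit   : ∀ k → re k * re k + im k * im k ≈ 1#
      im-pos : ∀ k → 1 ℕ.≤ k → k ℕ.< n → 0# < im k
      im-n   : im n ≈ 0#

    -- The real part of z^(j+k) times the conjugate of z^k, where |z^k| = 1. The form j + k avoids
    -- truncated subtraction of exponents.
    re-difference : ∀ j k → re (j ℕ.+ k) * re k + im (j ℕ.+ k) * im k ≈ re j
    re-difference j k = begin
      re (j ℕ.+ k) * re k + im (j ℕ.+ k) * im k
        ≈⟨ +-cong (*-congʳ (re-+ j k)) (*-congʳ (im-+ j k)) ⟩
      (re j * re k - im j * im k) * re k + (im j * re k + re j * im k) * im k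
        ≈⟨ solve 4 (λ a b c d → (a :* c :- b :* d) :* c :+ (b :* c :+ a :* d) :* d :=
             a :* (c :* c :+ d :* d)) refl _ _ _ _ ⟩
      re j * (re k * re k + im k * im k)   ≈⟨ *-congˡ (unit k) ⟩
      re j * 1#                            ≈⟨ *-identityʳ _ ⟩
      re j                                 ∎

    im-difference : ∀ j k → im (j ℕ.+ k) * re k - re (j ℕ.+ k) * im k ≈ im j
    im-difference j k = begin
      im (j ℕ.+ k) * re k - re (j ℕ.+ k) * im k
        ≈⟨ +-cong (*-congʳ (im-+ j k)) (-‿cong (*-congʳ (re-+ j k))) ⟩
      (im j * re k + re j * im k) * re k - (re j * re k - im j * im k) * im k
        ≈⟨ solve 4 (λ a b c d → (b :* c :+ a :* d) :* c :- (a :* c :- b :* d) :* d :=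
             b :* (c :* c :+ d :* d)) refl _ _ _ _ ⟩
      im j * (re k * re k + im k * im k)   ≈⟨ *-congˡ (unit k) ⟩
      im j * 1#                            ≈⟨ *-identityʳ _ ⟩
      im j                                 ∎

  -- The number c + d i is (1 + t i)²/(1 + t²), the half-angle parametrisation of the circle, given
  -- by equations free of denominators.
  module Rotation (t c d : Carrier) (Dc≈ : norm t * c ≈ 1# - t * t) (Dd≈ : norm t * d ≈ 2# * t) where
    private D = norm t

    D≉0 : ¬ D ≈ 0#
    D≉0 = pos⇒≉0 (norm-pos t)

    c²+d²≈1 : c * c + d * d ≈ 1#
    c²+d²≈1 = *-cancelˡ D≉0 (*-cancelˡ D≉0 (begin
      D * (D * (c * c + d * d))               ≈⟨ solve 3 (λ D c d → D :* (D :* (c :* c :+ d :* d)) :=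
                                                   D :* c :* (D :* c) :+ D :* d :* (D :* d)) refl D c d ⟩
      D * c * (D * c) + D * d * (D * d)       ≈⟨ +-cong (*-cong Dc≈ Dc≈) (*-cong Dd≈ Dd≈) ⟩
      (1# - t * t) * (1# - t * t) + 2# * t * (2# * t)
                                              ≈⟨ solve 1 (λ t → (:1 :- t :* t) :* (:1 :- t :* t) :+ :2 :* t :* (:2 :* t) :=
                                                   (:1 :+ t :* t) :* ((:1 :+ t :* t) :* :1)) refl t ⟩
      D * (D * 1#)                            ∎))

    re im : ℕ → Carrier
    re zero    = 1#
    re (suc k) = c * re k - d * im k
    im zero    = 0#
    im (suc k) = d * re k + c * im k

    re-+ : ∀ j k → re (j ℕ.+ k) ≈ re j * re k - im j * im k
    im-+ : ∀ j k → im (j ℕ.+ k) ≈ im j * re k + re j * im k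
    re-+ zero    k = solve 2 (λ x y → x := :1 :* x :- :0 :* y) refl _ _
    re-+ (suc j) k = trans (+-cong (*-congˡ (re-+ j k)) (-‿cong (*-congˡ (im-+ j k))))
      (solve 6 (λ c d x y z w → c :* (x :* z :- y :* w) :- d :* (y :* z :+ x :* w) :=
        (c :* x :- d :* y) :* z :- (d :* x :+ c :* y) :* w) refl c d (re j) (im j) (re k) (im k))
    im-+ zero    k = solve 2 (λ x y → y := :0 :* x :+ :1 :* y) refl (re k) (im k)
    im-+ (suc j) k = trans (+-cong (*-congˡ (re-+ j k)) (*-congˡ (im-+ j k)))
      (solve 6 (λ c d x y z w → d :* (x :* z :- y :* w) :+ c :* (y :* z :+ x :* w) :=
        (d :* x :+ c :* y) :* z :+ (c :* x :- d :* y) :* w) refl c d (re j) (im j) (re k) (im k))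

    unit : ∀ k → re k * re k + im k * im k ≈ 1#
    unit zero    = solve 0 (:1 :* :1 :+ :0 :* :0 := :1) refl
    unit (suc k) = begin
      re (suc k) * re (suc k) + im (suc k) * im (suc k)
        ≈⟨ solve 4 (λ c d x y → (c :* x :- d :* y) :* (c :* x :- d :* y) :+ (d :* x :+ c :* y) :* (d :* x :+ c :* y)
             := (c :* c :+ d :* d) :* (x :* x :+ y :* y)) refl c d (re k) (im k) ⟩
      (c * c + d * d) * (re k * re k + im k * im k)   ≈⟨ *-cong c²+d²≈1 (unit k) ⟩
      1# * 1#                                         ≈⟨ *-identityˡ 1# ⟩
      1#                                              ∎

    -- Both sides obey the same two-term recurrence, on the left because of c² + d² = 1. It
    -- transfers the signs and the zero of `chord` to `im`.
    im-chord : ∀ k → D ^ k * im k ≈ 2# * t * chord k t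
    im-chord zero = solve 1 (λ t → :1 :* :0 := :2 :* t :* :0) refl t
    im-chord (suc zero) = trans
      (solve 3 (λ D c d → D :* :1 :* (d :* :1 :+ c :* :0) := D :* d :* :1) refl D c d) (*-congʳ Dd≈)
    im-chord (suc (suc k)) = begin
      D * (D * D ^ k) * im (suc (suc k))
        ≈⟨ solve 6 (λ D p c d x y → D :* (D :* p) :* (d :* (c :* x :- d :* y) :+ c :* (d :* x :+ c :* y)) :=
             :2 :* (D :* c) :* (D :* p :* (d :* x :+ c :* y)) :- D :* D :* (c :* c :+ d :* d) :* (p :* y))
             refl D (D ^ k) c d (re k) (im k) ⟩
      2# * (D * c) * (D * D ^ k * im (suc k)) - D * D * (c * c + d * d) * (D ^ k * im k)
        ≈⟨ +-cong (*-cong (*-congˡ Dc≈) (im-chord (suc k))) (-‿cong (*-cong (*-congˡ c²+d²≈1) (im-chord k))) ⟩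
      2# * (1# - t * t) * (2# * t * chord (suc k) t) - D * D * 1# * (2# * t * chord k t)
        ≈⟨ solve 5 (λ A D t x y → A :* (:2 :* t :* x) :- D :* D :* :1 :* (:2 :* t :* y) :=
             :2 :* t :* (A :* x :- D :* D :* y)) refl _ D t _ _ ⟩
      2# * t * chord (suc (suc k)) t ∎

  halfTurn : ∀ n → HalfTurn (2 ℕ.+ n)
  halfTurn n = record
    { re = re
    ; im = im
    ; re-+ = re-+
    ; im-+ = im-+
    ; unit = unit
    ; im-pos = λ k 1≤k k<n → cancel-pos-< (^-pos (norm-pos s) k) (<-respʳ-≈ (sym (im-chord  k))
        (*-pos _ _ (*-pos _ _ 0<2 0<s) (earlier k 1≤k k<n s 0≤s ≤-refl)))
    ; im-n = *-cancelˡ (pos⇒≉0 (^-pos (norm-pos s) (2 ℕ.+ n)))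
        (trans (im-chord  (2 ℕ.+ n)) (trans (*-congˡ vanishes) (trans (zeroʳ _) (sym (zeroʳ _)))))
    }
    where
    open LeastZero (leastZero n)
    c = norm s ⁻¹ * (1# - s * s)
    d = norm s ⁻¹ * (2# * s)
    D*[D⁻¹*x]≈x : ∀ x → norm s * (norm s ⁻¹ * x) ≈ x
    D*[D⁻¹*x]≈x x = trans (sym (*-assoc _ _ _))
      (trans (*-congʳ (inverse _ (pos⇒≉0 (norm-pos s)))) (*-identityˡ x))
    Dc≈ = D*[D⁻¹*x]≈x (1# - s * s)
    Dd≈ = D*[D⁻¹*x]≈x (2# * s)
    open Rotation s c d Dc≈ Dd≈
    0<s : 0# < s
    0<s = ≤∧≉⇒< 0≤s λ 0≈s → pos⇒≉0 (ι-pos (suc n)) (trans (sym (chord-0 (2 ℕ.+ n)))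
      (trans (lipschitz-cong (chord-lipschitz (2 ℕ.+ n)) 0≈s) vanishes))

  module HalfTurnProperties {n} (H : HalfTurn (2 ℕ.+ n)) where
    open HalfTurn H public

    -- As `im` vanishes there, the value is ±1. With +1, z^(n+1) would be the conjugate of z,
    -- although both have positive imaginary part.
    re-n : re (2 ℕ.+ n) ≈ - 1#
    re-n with square≈1 (trans (sym (trans (+-congˡ (trans (*-congʳ im-n) (zeroˡ _))) (+-identityʳ _)))
                              (unit (2 ℕ.+ n)))
    ... | inj₂ re≈-1 = re≈-1
    ... | inj₁ re≈1  = ⊥-elim (<-irrefl (sym im-sum≈0) (0<+ 0<im₁ 0<imₙ₋₁))
      where
      0<im₁ = im-pos 1 (s≤s z≤n) (s≤s (s≤s z≤n))
      0<imₙ₋₁ = im-pos (suc n) (s≤s z≤n) ℕₚ.≤-refl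
      n≡ : suc n ℕ.+ 1 ≡ 2 ℕ.+ n
      n≡ = ℕₚ.+-comm (suc n) 1
      im-sum≈0 : im 1 + im (suc n) ≈ 0#
      im-sum≈0 = begin
        im 1 + im (suc n)
          ≈⟨ +-congˡ (im-difference (suc n) 1) ⟨
        im 1 + (im (suc n ℕ.+ 1) * re 1 - re (suc n ℕ.+ 1) * im 1)
          ≈⟨ +-congˡ (+-cong (*-congʳ (trans (reflexive (≡.cong im n≡)) im-n))
                             (-‿cong (*-congʳ (trans (reflexive (≡.cong re n≡)) re≈1)))) ⟩
        im 1 + (0# * re 1 - 1# * im 1)
          ≈⟨ solve 2 (λ x y → y :+ (:0 :* x :- :1 :* y) := :0) refl (re 1) (im 1) ⟩
        0# ∎

    -- The rule cos(π - x) = -cos x; it brings the obtuse counterparts -`re k` back into the list of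
    -- values `re j`.
    re-reflect : ∀ j k → j ℕ.+ k ≡ 2 ℕ.+ n → re j ≈ - re k
    re-reflect j k j+k≡n = begin
      re j                                       ≈⟨ re-difference j k ⟨
      re (j ℕ.+ k) * re k + im (j ℕ.+ k) * im k  ≈⟨ +-cong (*-congʳ (trans (reflexive (≡.cong re j+k≡n)) re-n))
                                                           (*-congʳ (trans (reflexive (≡.cong im j+k≡n)) im-n)) ⟩
      - 1# * re k + 0# * im k                    ≈⟨ solve 2 (λ x y → (:- :1) :* x :+ :0 :* y := :- x) refl (re k) (im k) ⟩
      - re k                                     ∎

open import Data.Nat.Base using (_>_; _≤_; _∸_)

-- Counting values and taking minima with excluded middle.

module Enumeration (em : ExcludedMiddle 0ℓ) (R : RealNumbers) where
  open OrderedField R using (Carrier; _≈_; sym; trans)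

  -- V is covered by m classes `Q a`, each holding at most one value, so listing one value per
  -- inhabited class exhausts V.
  enumerate : ∀ m (V : Carrier → Set) (Q : Fin m → Carrier → Set) →
    (∀ a {x y} → V x → V y → Q a x → Q a y → x ≈ y) →
    (∀ x → V x → ∃[ a ] Q a x) →
    ∃[ k ] k ≤ m × ∃[ Θ ] Injective _≡_ _≈_ Θ × (∀ (a : Fin k) → V (Θ a)) ×
      (∀ x → V x → ∃[ a ] x ≈ Θ a)
  enumerate zero V Q unique cover = zero , z≤n , (λ ()) , (λ {}) , (λ ()) ,
    λ x Vx → case-empty (proj₁ (cover x Vx))
    where
    case-empty : ∀ {A : Set} → Fin 0 → A
    case-empty ()
  enumerate (suc m) V Q unique cover with em {∃[ x ] V x × Q 0F x}
  ... | no none =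
    let k , k≤m , rest = enumerate m V (Q ∘ Fin.suc) (λ a → unique (Fin.suc a)) cover′
    in k , ℕₚ.m≤n⇒m≤1+n k≤m , rest
    where
    cover′ : ∀ x → V x → ∃[ a ] Q (Fin.suc a) x
    cover′ x Vx with cover x Vx
    ... | Fin.zero  , q = ⊥-elim (none (x , Vx , q))
    ... | Fin.suc a , q = a , q
  ... | yes (x₀ , Vx₀ , Q₀x₀) = suc k , s≤s k≤m , Θ′ , injective′ , values′ , covers′
    where
    -- Classes may overlap, so x₀ is removed from V before the remaining classes are listed; this
    -- keeps the list injective.
    cover′ : ∀ x → V x × ¬ x ≈ x₀ → ∃[ a ] Q (Fin.suc a) x
    cover′ x (Vx , x≉x₀) with cover x Vx
    ... | Fin.zero  , q = ⊥-elim (x≉x₀ (unique 0F Vx Vx₀ q Q₀x₀))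
    ... | Fin.suc a , q = a , q
    rest = enumerate m (λ x → V x × ¬ x ≈ x₀) (Q ∘ Fin.suc)
      (λ a (Vx , _) (Vy , _) → unique (Fin.suc a) Vx Vy) cover′
    k = proj₁ rest
    k≤m = proj₁ (proj₂ rest)
    Θ = proj₁ (proj₂ (proj₂ rest))
    injective = proj₁ (proj₂ (proj₂ (proj₂ rest)))
    values = proj₁ (proj₂ (proj₂ (proj₂ (proj₂ rest))))
    covers = proj₂ (proj₂ (proj₂ (proj₂ (proj₂ rest))))
    Θ′ : Fin (suc k) → Carrier
    Θ′ Fin.zero    = x₀
    Θ′ (Fin.suc a) = Θ a
    injective′ : Injective _≡_ _≈_ Θ′
    injective′ {Fin.zero}  {Fin.zero}  _  = ≡.refl
    injective′ {Fin.zero}  {Fin.suc b} eq = ⊥-elim (proj₂ (values b) (sym eq))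
    injective′ {Fin.suc a} {Fin.zero}  eq = ⊥-elim (proj₂ (values a) eq)
    injective′ {Fin.suc a} {Fin.suc b} eq = ≡.cong Fin.suc (injective eq)
    values′ : ∀ a → V (Θ′ a)
    values′ Fin.zero    = Vx₀
    values′ (Fin.suc a) = proj₁ (values a)
    covers′ : ∀ x → V x → ∃[ a ] x ≈ Θ′ a
    covers′ x Vx with em {x ≈ x₀}
    ... | yes x≈x₀ = 0F , x≈x₀
    ... | no  x≉x₀ = let a , x≈ = covers x (Vx , x≉x₀) in Fin.suc a , x≈

  -- The number b only bounds the length of the descent from k to smaller elements of A.
  least : (A : ℕ → Set) → ∀ b k → k ≤ b → A k → ∃[ m ] (A m × (∀ j → A j → m ≤ j)) × m ≤ k
  least A b k k≤b Ak with em {∃[ j ] j ℕ.< k × A j}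
  ... | no none = k , (Ak , λ j Aj → ℕₚ.≮⇒≥ λ j<k → none (j , j<k , Aj)) , ℕₚ.≤-refl
  least A zero    zero z≤n Ak | yes (j , () , _)
  least A (suc b) k k≤b Ak | yes (j , j<k , Aj) =
    let m , isLeast , m≤j = least A b j (ℕₚ.≤-pred (ℕₚ.≤-trans j<k k≤b)) Aj
    in m , isLeast , ℕₚ.≤-trans m≤j (ℕₚ.<⇒≤ j<k)

-- The configuration and the cosines of its angles.

module Configuration (R : RealNumbers) (n : ℕ) (H : RootOfUnity.HalfTurn R (4 ℕ.+ n)) where
  open OrderedField R renaming (_≤_ to _≤ᴿ_)
  open Plane R
  open RootOfUnity R
  open HalfTurnProperties H
  open import Relation.Binary.Reasoning.Setoid setoid

  N : ℕ
  N = 4 ℕ.+ n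

  cot : ℕ → Carrier
  cot k = re k * im k ⁻¹

  Direction : ℕ → Set
  Direction k = 1 ≤ k × k ℕ.< N

  im>0 : ∀ {k} → Direction k → 0# < im k
  im>0 (1≤k , k<N) = im-pos _ 1≤k k<N

  cot*im : ∀ {k} → Direction k → cot k * im k ≈ re k
  cot*im {k} dir = trans (solve 3 (λ x i y → x :* i :* y := x :* (y :* i)) refl _ _ _)
    (trans (*-congˡ (inverse (im k) (pos⇒≉0 (im>0 dir)))) (*-identityʳ _))

  -- The identity sin x sin y (cot x - cot y) = sin(y - x), whose right side is positive here.
  cot-decreasing : ∀ {j k} → Direction j → Direction k → j ℕ.< k → cot k < cot j
  cot-decreasing {j} {k} dj dk j<k = <-by
    (cancel-pos-< (*-pos _ _ (im>0 dj) (im>0 dk)) (<-respʳ-≈ (sym scaled) 0<im[k-j])) refl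
    where
    0<im[k-j] : 0# < im (k ∸ j)
    0<im[k-j] = im-pos (k ∸ j) (ℕₚ.m<n⇒0<n∸m j<k) (ℕₚ.≤-<-trans (ℕₚ.m∸n≤m k j) (proj₂ dk))
    k≡ : k ∸ j ℕ.+ j ≡ k
    k≡ = ℕₚ.m∸n+n≡m (ℕₚ.<⇒≤ j<k)
    scaled : im j * im k * (cot j - cot k) ≈ im (k ∸ j)
    scaled = begin
      im j * im k * (cot j - cot k)
        ≈⟨ solve 4 (λ i l x y → i :* l :* (x :- y) := l :* (x :* i) :- (y :* l) :* i) refl _ _ _ _ ⟩
      im k * (cot j * im j) - cot k * im k * im j
        ≈⟨ +-cong (*-congˡ (cot*im dj)) (-‿cong (*-congʳ (cot*im dk))) ⟩
      im k * re j - re k * im j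
        ≡⟨ ≡.cong (λ l → im l * re j - re l * im j) k≡ ⟨
      im (k ∸ j ℕ.+ j) * re j - re (k ∸ j ℕ.+ j) * im j
        ≈⟨ im-difference (k ∸ j) j ⟩
      im (k ∸ j) ∎

  cot-injective : ∀ {j k} → Direction j → Direction k → cot j ≈ cot k → j ≡ k
  cot-injective {j} {k} dj dk eq with ℕₚ.<-cmp j k
  ... | tri< j<k _ _ = ⊥-elim (<-irrefl (sym eq) (cot-decreasing dj dk j<k))
  ... | tri≈ _ j≡k _ = j≡k
  ... | tri> _ _ k<j = ⊥-elim (<-irrefl eq (cot-decreasing dk dj k<j))

  index : Fin (3 ℕ.+ n) → ℕ
  index i = suc (toℕ i)

  direction : ∀ i → Direction (index i)
  direction i = s≤s z≤n , s≤s (Finₚ.toℕ<n i)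

  index-injective : ∀ {i j} → index i ≡ index j → i ≡ j
  index-injective eq = Finₚ.toℕ-injective (ℕₚ.suc-injective eq)

  -- The line through q k and the point (0,1) makes the angle kπ/N with the axis.
  q : ℕ → Point
  q k = cot k , 0#

  points : Config N
  points Fin.zero    = 0# , 1#
  points (Fin.suc i) = q (index i)

  distinct : Distinct points
  distinct {Fin.zero}  {Fin.zero}  _         = ≡.refl
  distinct {Fin.zero}  {Fin.suc j} (_ , 1≈0) = ⊥-elim (1≉0 1≈0)
  distinct {Fin.suc i} {Fin.zero}  (_ , 0≈1) = ⊥-elim (1≉0 (sym 0≈1))
  distinct {Fin.suc i} {Fin.suc j} (eq , _)  =
    ≡.cong Fin.suc (index-injective (cot-injective (direction i) (direction j) eq))

  noncollinear : ¬ Collinear points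
  noncollinear ((u₁ , u₂) , c , u≉0 , u∙P≈c) = u≉0 (u₁≈0 , u₂≈0)
    where
    x y : Carrier
    x = cot 1
    y = cot 2
    y<x : y < x
    y<x = cot-decreasing (direction 0F) (direction 1F) (s≤s (s≤s z≤n))
    u₁≈0 : u₁ ≈ 0#
    u₁≈0 = [ (λ e → e) , (λ e → ⊥-elim (pos⇒≉0 (x<y⇒0<y-x y<x) e)) ]′ (zero-product
      (trans (solve 4 (λ u v x y → u :* (x :- y) := u :* x :+ v :* :0 :- (u :* y :+ v :* :0)) refl u₁ u₂ x y)
        (x≈y⇒x-y≈0 (trans (u∙P≈c 1F) (sym (u∙P≈c 2F))))))
    u₂≈0 : u₂ ≈ 0#
    u₂≈0 = begin
      u₂                    ≈⟨ solve 2 (λ u v → v := u :* :0 :+ v :* :1) refl u₁ u₂ ⟩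
      u₁ * 0# + u₂ * 1#     ≈⟨ trans (u∙P≈c 0F) (sym (u∙P≈c 1F)) ⟩
      u₁ * x + u₂ * 0#      ≈⟨ +-cong (*-congʳ u₁≈0) (zeroʳ u₂) ⟩
      0# * x + 0#           ≈⟨ trans (+-identityʳ _) (zeroˡ x) ⟩
      0#                    ∎

  -- The centre lies on the perpendicular bisector of the two points, so their midpoint has abscissa
  -- o₁. One point of the axis on the circle therefore determines the other.
  same-circle : ∀ {x y} o₁ o₂ ρ → ¬ x ≈ y → OnCircle (o₁ , o₂) ρ (x , 0#) →
                OnCircle (o₁ , o₂) ρ (y , 0#) → x + y ≈ o₁ + o₁
  same-circle {x} {y} o₁ o₂ ρ x≉y onx ony =
    [ (λ e → ⊥-elim (x≉y (x-y≈0⇒x≈y e))) , x-y≈0⇒x≈y ]′ (zero-product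
      (trans (solve 4 (λ x y a b → (x :- y) :* (x :+ y :- (a :+ a)) :=
          (x :- a) :* (x :- a) :+ (:0 :- b) :* (:0 :- b) :- ((y :- a) :* (y :- a) :+ (:0 :- b) :* (:0 :- b)))
          refl x y o₁ o₂)
        (x≈y⇒x-y≈0 (trans onx (sym ony)))))

  q-separated : ∀ {i j} → i ≢ j → ¬ cot (index i) ≈ cot (index j)
  q-separated i≢j eq = i≢j (index-injective (cot-injective (direction _) (direction _) eq))

  three-on-line : ∀ {o ρ} i j k → i ≢ j → i ≢ k → j ≢ k → i ≢ 0F → j ≢ 0F → k ≢ 0F →
    OnCircle o ρ (points i) → OnCircle o ρ (points j) → ¬ OnCircle o ρ (points k)
  three-on-line Fin.zero j k _ _ _ i≢0 _ _ _ _ _ = i≢0 ≡.refl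
  three-on-line (Fin.suc i) Fin.zero k _ _ _ _ j≢0 _ _ _ _ = j≢0 ≡.refl
  three-on-line (Fin.suc i) (Fin.suc j) Fin.zero _ _ _ _ _ k≢0 _ _ _ = k≢0 ≡.refl
  three-on-line {o₁ , o₂} {ρ} (Fin.suc i) (Fin.suc j) (Fin.suc k) i≢j i≢k j≢k _ _ _ oni onj onk =
    q-separated (j≢k ∘ ≡.cong Fin.suc) (≈-by
      (trans (same-circle o₁ o₂ ρ (q-separated (i≢j ∘ ≡.cong Fin.suc)) oni onj)
        (sym (same-circle o₁ o₂ ρ (q-separated (i≢k ∘ ≡.cong Fin.suc)) oni onk)))
      (solve 3 (λ x y z → y :- z := x :+ y :- (x :+ z)) refl _ _ _))

  no-four-concyclic : NoFourConcyclic points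
  no-four-concyclic (f , f-inj , o , ρ , _ , on) =
    cases (f 0F Finₚ.≟ 0F) (f 1F Finₚ.≟ 0F) (f 2F Finₚ.≟ 0F)
    where
    three : ∀ a b c → a ≢ b → a ≢ c → b ≢ c → f a ≢ 0F → f b ≢ 0F → f c ≢ 0F → ⊥
    three a b c a≢b a≢c b≢c a≢0 b≢0 c≢0 = three-on-line (f a) (f b) (f c)
      (a≢b ∘ f-inj) (a≢c ∘ f-inj) (b≢c ∘ f-inj) a≢0 b≢0 c≢0 (on a) (on b) (on c)
    others : ∀ {a} → f a ≡ 0F → ∀ b → b ≢ a → f b ≢ 0F
    others fa≡0 b b≢a fb≡0 = b≢a (f-inj (≡.trans fb≡0 (≡.sym fa≡0)))
    cases : _ → _ → _ → ⊥
    cases (yes e₀) _ _ = three 1F 2F 3F (λ ()) (λ ()) (λ ())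
      (others e₀ 1F λ ()) (others e₀ 2F λ ()) (others e₀ 3F λ ())
    cases (no ne₀) (yes e₁) _ = three 0F 2F 3F (λ ()) (λ ()) (λ ())
      ne₀ (others e₁ 2F λ ()) (others e₁ 3F λ ())
    cases (no ne₀) (no ne₁) (yes e₂) = three 0F 1F 3F (λ ()) (λ ()) (λ ())
      ne₀ ne₁ (others e₂ 3F λ ())
    cases (no ne₀) (no ne₁) (no ne₂) = three 0F 1F 2F (λ ()) (λ ()) (λ ()) ne₀ ne₁ ne₂

  -- The second half of `IsAngleBetween` with θ removed, leaving a purely algebraic condition.
  IsCosine : Point → Point → Carrier → Set
  IsCosine u v c = ∃[ r ] ∃[ s ] IsNorm u r × IsNorm v s × r * s * c ≈ u ∙ v

  IsCosine-sym : ∀ u v {c} → IsCosine u v c → IsCosine v u c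
  IsCosine-sym (u₁ , u₂) (v₁ , v₂) (r , s , nr , ns , eq) = s , r , ns , nr ,
    trans (*-congʳ (*-comm s r)) (trans eq
      (solve 4 (λ a b c d → a :* c :+ b :* d := c :* a :+ d :* b) refl u₁ u₂ v₁ v₂))

  -- By cot² + 1 = 1/sin², the distance from `q k` to (0,1) is 1/`im k`. The squared length u is
  -- left general, to fit both orders of subtraction.
  slant : ∀ {k} r {u} → Direction k → 0# ≤ᴿ r → r * r ≈ u → u ≈ cot k * cot k + 1# → r * im k ≈ 1#
  slant {k} r {u} dk 0≤r rr≈u u≈ = square-injective-≥0 (0≤* 0≤r (<⇒≤ (im>0 dk))) 0<1 (begin
    r * im k * (r * im k)                            ≈⟨ solve 2 (λ r i → r :* i :* (r :* i) := r :* r :* (i :* i)) refl _ _ ⟩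
    r * r * (im k * im k)                            ≈⟨ *-congʳ (trans rr≈u u≈) ⟩
    (cot k * cot k + 1#) * (im k * im k)             ≈⟨ solve 2 (λ x i → (x :* x :+ :1) :* (i :* i) := x :* i :* (x :* i) :+ i :* i) refl _ _ ⟩
    cot k * im k * (cot k * im k) + im k * im k      ≈⟨ +-congʳ (*-cong (cot*im dk) (cot*im dk)) ⟩
    re k * re k + im k * im k                        ≈⟨ unit k ⟩
    1#                                               ≈⟨ *-identityˡ 1# ⟨
    1# * 1#                                          ∎)

  -- After multiplication by the two sines the lengths become 1, and the inner product cot x cot y +
  -- 1 becomes cos x cos y + sin x sin y.
  apex-cosine : ∀ d {j c} → Direction j → Direction (d ℕ.+ j) →
    IsCosine (q (d ℕ.+ j) -ₚ (0# , 1#)) (q j -ₚ (0# , 1#)) c → c ≈ re d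
  apex-cosine d {j} {c} dj dk (r , s , (0≤r , rr≈) , (0≤s , ss≈) , rsc≈) = begin
    c                                                  ≈⟨ solve 1 (λ c → c := :1 :* :1 :* c) refl c ⟩
    1# * 1# * c                                        ≈⟨ *-congʳ (*-cong (slant r dk 0≤r rr≈ (expand (cot k))) (slant s dj 0≤s ss≈ (expand (cot j)))) ⟨
    r * im k * (s * im j) * c                          ≈⟨ solve 5 (λ r a s b c → r :* a :* (s :* b) :* c := a :* b :* (r :* s :* c)) refl _ _ _ _ _ ⟩
    im k * im j * (r * s * c)                          ≈⟨ *-congˡ rsc≈ ⟩
    im k * im j * ((cot k - 0#) * (cot j - 0#) + (0# - 1#) * (0# - 1#))
                                                       ≈⟨ solve 4 (λ a b x y → a :* b :* ((x :- :0) :* (y :- :0) :+ (:0 :- :1) :* (:0 :- :1)) :=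
                                                            x :* a :* (y :* b) :+ a :* b) refl _ _ _ _ ⟩
    cot k * im k * (cot j * im j) + im k * im j        ≈⟨ +-congʳ (*-cong (cot*im dk) (cot*im dj)) ⟩
    re k * re j + im k * im j                          ≈⟨ re-difference d j ⟩
    re d                                               ∎
    where
    k = d ℕ.+ j
    expand : ∀ x → (x - 0#) * (x - 0#) + (0# - 1#) * (0# - 1#) ≈ x * x + 1#
    expand = solve 1 (λ x → (x :- :0) :* (x :- :0) :+ (:0 :- :1) :* (:0 :- :1) := x :* x :+ :1) refl

  module Base {j l c} (dj : Direction j) (dl : Direction l)
    (angle : IsCosine ((0# , 1#) -ₚ q j) (q l -ₚ q j) c) where
    private
      r = proj₁ angle
      s = proj₁ (proj₂ angle)
      norm-r = proj₁ (proj₂ (proj₂ angle))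
      norm-s = proj₁ (proj₂ (proj₂ (proj₂ angle)))
      rsc≈ = proj₂ (proj₂ (proj₂ (proj₂ angle)))
      x = cot j
      y = cot l

    r*im : r * im j ≈ 1#
    r*im = slant r dj (proj₁ norm-r) (proj₂ norm-r)
      (solve 1 (λ x → (:0 :- x) :* (:0 :- x) :+ (:1 :- :0) :* (:1 :- :0) := x :* x :+ :1) refl x)

    length : ∀ {z} → 0# < z → z * z ≈ (y - x) * (y - x) → s ≈ z
    length 0<z zz≈ = square-injective-≥0 (proj₁ norm-s) 0<z (trans (proj₂ norm-s)
      (trans (solve 1 (λ z → z :+ (:0 :- :0) :* (:0 :- :0) := z) refl _) (sym zz≈)))

    -- Here z is the distance |y - x| and w is x or -x, with the sign that makes z w the inner
    -- product.
    cosine : ∀ {z w} → 0# < z → s ≈ z → x * (x - y) ≈ z * w → c ≈ im j * w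
    cosine {z} {w} 0<z s≈z xxy≈ = *-cancelˡ (pos⇒≉0 0<z) (begin
      z * c                       ≈⟨ solve 2 (λ z c → z :* c := :1 :* z :* c) refl z c ⟩
      1# * z * c                  ≈⟨ *-congʳ (*-cong r*im s≈z) ⟨
      r * im j * s * c            ≈⟨ solve 4 (λ r i s c → r :* i :* s :* c := i :* (r :* s :* c)) refl _ _ _ _ ⟩
      im j * (r * s * c)          ≈⟨ *-congˡ rsc≈ ⟩
      im j * ((0# - x) * (y - x) + (1# - 0#) * (0# - 0#))
                                  ≈⟨ *-congˡ (solve 2 (λ x y → (:0 :- x) :* (y :- x) :+ (:1 :- :0) :* (:0 :- :0) := x :* (x :- y)) refl x y) ⟩
      im j * (x * (x - y))        ≈⟨ *-congˡ xxy≈ ⟩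
      im j * (z * w)              ≈⟨ solve 3 (λ i z w → i :* (z :* w) := z :* (i :* w)) refl _ _ _ ⟩
      z * (im j * w)              ∎)

    -- Since `cot` decreases, `q l` with j < l has the smaller abscissa, and |y - x| = x - y.
    right-cosine : j ℕ.< l → c ≈ re j
    right-cosine j<l = trans (cosine 0<x-y (length 0<x-y
        (solve 2 (λ x y → (x :- y) :* (x :- y) := (y :- x) :* (y :- x)) refl x y)) (*-comm _ _))
      (trans (*-comm _ _) (cot*im dj))
      where 0<x-y = x<y⇒0<y-x (cot-decreasing dj dl j<l)

    left-cosine : l ℕ.< j → c ≈ - re j
    left-cosine l<j = trans (cosine 0<y-x (length 0<y-x refl)
        (solve 2 (λ x y → x :* (x :- y) := (y :- x) :* (:- x)) refl x y))
      (trans (solve 2 (λ i x → i :* (:- x) := :- (x :* i)) refl _ _) (-‿cong (cot*im dj)))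
      where 0<y-x = x<y⇒0<y-x (cot-decreasing dl dj l<j)

  -- Squaring r s c = X Z removes the signs of X and Z, hence the distinction between the angles 0
  -- and π.
  straight-cosine : ∀ {x y z c} → ¬ x ≈ y → ¬ z ≈ y →
    IsCosine ((x , 0#) -ₚ (y , 0#)) ((z , 0#) -ₚ (y , 0#)) c → c * c ≈ 1#
  straight-cosine {x} {y} {z} {c} x≉y z≉y (r , s , (_ , rr≈) , (_ , ss≈) , rsc≈) =
    *-cancelˡ (X*X≉0 x≉y) (*-cancelˡ (X*X≉0 z≉y) (begin
      Z * Z * (X * X * (c * c))    ≈⟨ solve 3 (λ X Z c → Z :* Z :* (X :* X :* (c :* c)) :=
                                        (X :* X :+ O) :* (Z :* Z :+ O) :* (c :* c)) refl X Z c ⟩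
      (X * X + o) * (Z * Z + o) * (c * c)   ≈⟨ *-congʳ (*-cong rr≈ ss≈) ⟨
      r * r * (s * s) * (c * c)    ≈⟨ solve 3 (λ r s c → r :* r :* (s :* s) :* (c :* c) := r :* s :* c :* (r :* s :* c)) refl r s c ⟩
      r * s * c * (r * s * c)      ≈⟨ *-cong rsc≈ rsc≈ ⟩
      (X * Z + o) * (X * Z + o)    ≈⟨ solve 2 (λ X Z → (X :* Z :+ O) :* (X :* Z :+ O) := Z :* Z :* (X :* X :* :1)) refl X Z ⟩
      Z * Z * (X * X * 1#)         ∎))
    where
    X Z o : Carrier
    X = x - y
    Z = z - y
    o = (0# - 0#) * (0# - 0#)
    O : ∀ {k} → Polynomial k
    O = (:0 :- :0) :* (:0 :- :0)
    X*X≉0 : ∀ {x y} → ¬ x ≈ y → ¬ (x - y) * (x - y) ≈ 0#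
    X*X≉0 x≉y e = x≉y (x-y≈0⇒x≈y ([ (λ e → e) , (λ e → e) ]′ (zero-product e)))

  Listed : Carrier → Set
  Listed c = ∃[ a ] c ≈ re (suc (toℕ {2 ℕ.+ n} a))

  listed : ∀ {c} d → 1 ≤ d → d ≤ 2 ℕ.+ n → c ≈ re d → Listed c
  listed (suc d) _ d<n c≈ = fromℕ< d<n ,
    trans c≈ (reflexive (≡.cong (re ∘ suc) (≡.sym (Finₚ.toℕ-fromℕ< d<n))))

  apex-listed : ∀ i j → index j ℕ.< index i → ∀ {c} →
    IsCosine (points (Fin.suc i) -ₚ points 0F) (points (Fin.suc j) -ₚ points 0F) c → Listed c
  apex-listed i j j<i {c} angle = listed d (ℕₚ.m<n⇒0<n∸m j<i)
    -- Both indices lie between 1 and N - 1, so their difference is at most N - 2.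
    (ℕₚ.≤-pred (ℕₚ.≤-trans (ℕₚ.≤-trans (ℕₚ.≤-reflexive (ℕₚ.+-comm 1 d)) (ℕₚ.+-monoʳ-≤ d (s≤s z≤n)))
      (ℕₚ.≤-trans (ℕₚ.≤-reflexive i≡) (Finₚ.toℕ<n i))))
    (apex-cosine d (direction j) (≡.subst Direction (≡.sym i≡) (direction i))
      (≡.subst (λ k → IsCosine (q k -ₚ points 0F) (q (index j) -ₚ points 0F) c) (≡.sym i≡) angle))
    where
    d = index i ∸ index j
    i≡ : d ℕ.+ index j ≡ index i
    i≡ = ℕₚ.m∸n+n≡m (ℕₚ.<⇒≤ j<i)

  base-listed : ∀ j l → j ≢ l → ∀ {c} →
    IsCosine (points 0F -ₚ points (Fin.suc j)) (points (Fin.suc l) -ₚ points (Fin.suc j)) c → Listed c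
  base-listed j l j≢l angle with ℕₚ.<-cmp (index j) (index l)
  -- From j < l ≤ N - 1 follows j ≤ N - 2.
  ... | tri< j<l _ _ = listed (index j) (s≤s z≤n) (ℕₚ.≤-pred (ℕₚ.≤-trans j<l (Finₚ.toℕ<n l)))
          (Base.right-cosine (direction j) (direction l) angle j<l)
  ... | tri≈ _ j≡l _ = ⊥-elim (j≢l (index-injective j≡l))
  -- From 1 ≤ l < j follows j ≥ 2, so N - j ≤ N - 2.
  ... | tri> _ _ l<j = listed (N ∸ index j) (ℕₚ.m<n⇒0<n∸m (proj₂ (direction j)))
          (ℕₚ.∸-monoʳ-≤ N (ℕₚ.≤-trans (s≤s (s≤s z≤n)) l<j))
          (trans (Base.left-cosine (direction j) (direction l) angle l<j)
            (sym (re-reflect (N ∸ index j) (index j) (ℕₚ.m∸n+n≡m (ℕₚ.<⇒≤ (proj₂ (direction j)))))))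

  cosine-listed : ∀ i j k → i ≢ j → j ≢ k → i ≢ k → ∀ {c} → ¬ c * c ≈ 1# →
    IsCosine (points i -ₚ points j) (points k -ₚ points j) c → Listed c
  cosine-listed Fin.zero Fin.zero k i≢j _ _ _ _ = ⊥-elim (i≢j ≡.refl)
  cosine-listed (Fin.suc i) Fin.zero Fin.zero _ j≢k _ _ _ = ⊥-elim (j≢k ≡.refl)
  cosine-listed (Fin.suc i) Fin.zero (Fin.suc k) _ _ i≢k _ angle with ℕₚ.<-cmp (index i) (index k)
  ... | tri< i<k _ _ = apex-listed k i i<k
          (IsCosine-sym (points (Fin.suc i) -ₚ points 0F) (points (Fin.suc k) -ₚ points 0F) angle)
  ... | tri≈ _ i≡k _ = ⊥-elim (i≢k (≡.cong Fin.suc (index-injective i≡k)))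
  ... | tri> _ _ k<i = apex-listed i k k<i angle
  cosine-listed Fin.zero (Fin.suc j) Fin.zero _ _ i≢k _ _ = ⊥-elim (i≢k ≡.refl)
  cosine-listed Fin.zero (Fin.suc j) (Fin.suc k) _ j≢k _ _ angle =
    base-listed j k (j≢k ∘ ≡.cong Fin.suc) angle
  cosine-listed (Fin.suc i) (Fin.suc j) Fin.zero i≢j _ _ _ angle =
    base-listed j i (i≢j ∘ ≡.cong Fin.suc ∘ ≡.sym)
      (IsCosine-sym (points (Fin.suc i) -ₚ points (Fin.suc j)) (points 0F -ₚ points (Fin.suc j)) angle)
  cosine-listed (Fin.suc i) (Fin.suc j) (Fin.suc k) i≢j j≢k _ c²≉1 angle = ⊥-elim (c²≉1
    (straight-cosine (q-separated (i≢j ∘ ≡.cong Fin.suc))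
                     (q-separated (j≢k ∘ ≡.cong Fin.suc ∘ ≡.sym)) angle))

lemma2p9 : ExcludedMiddle 0ℓ → (R : RealNumbers) →
    ∀ (n : ℕ) → n > 3 → ∃[ m ] Plane.IsAno4c R n m × m ≤ n ∸ 2
lemma2p9 em R 1 (s≤s ())
lemma2p9 em R 2 (s≤s (s≤s ()))
lemma2p9 em R 3 (s≤s (s≤s (s≤s ())))
lemma2p9 em R (suc (suc (suc (suc n)))) _ =
  let k , k≤n-2 , isA = enumerate (2 ℕ.+ n) (AngleValue points) HasCosine unique cover
      m , isMin , m≤k = least (Attained N) k k ℕₚ.≤-refl
        (points , distinct , noncollinear , no-four-concyclic , isA)
  in m , isMin , ℕₚ.≤-trans m≤k k≤n-2
  where
  open OrderedField R using (Carrier; _≈_; _*_; 1#; trans; sym)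
  open Analysis R using (Cos)
  open Plane R using (AngleValue; Attained)
  open Enumeration em R
  open CosineInjectivity em R using (StrictAngle; Cos²≉1; Cos-injective)
  H = RootOfUnity.halfTurn R (2 ℕ.+ n)
  open RootOfUnity.HalfTurn H using (re)
  open Configuration R n H
  -- One class for each of the N - 2 listed cosines; injectivity of the cosine leaves at most one
  -- angle in each.
  HasCosine : Fin (2 ℕ.+ n) → Carrier → Set
  HasCosine a θ = ∃[ c ] Cos θ c × c ≈ re (suc (toℕ a))
  unique : ∀ a {θ θ′} → AngleValue points θ → AngleValue points θ′ →
           HasCosine a θ → HasCosine a θ′ → θ ≈ θ′
  unique a (strict , _) (strict′ , _) (c , θ↦c , c≈) (c′ , θ′↦c′ , c′≈) =
    Cos-injective strict strict′ θ↦c θ′↦c′ (trans c≈ (sym c′≈))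
  cover : ∀ θ → AngleValue points θ → ∃[ a ] HasCosine a θ
  cover θ (strict , i , j , k , i≢j , j≢k , i≢k , _ , r , s , c , nr , ns , θ↦c , rsc≈) =
    let a , c≈ = cosine-listed i j k i≢j j≢k i≢k (Cos²≉1 strict θ↦c) (r , s , nr , ns , rsc≈)
    in a , c , θ↦c , c≈
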